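{- Let $T$ be a theory (a set of sentences of the language of arithmetic) such that the set $\mathcal{Pr}_T$ of Gödel numbers of sentences provable in $T$ is definable in the standard model $\omega$ (in particular, this covers the case where $T$ is recursively axiomatizable). If $T$ is sound, then $T$ is incomplete.
   Context: Fix a standard first-order language of arithmetic (with equality, constant $0$, unary function symbol $s$, binary function symbols $+,\cdot$, order $\le$ primitive or defined) and a standard Gödel numbering. Formulas and sentences are those of this language. A theory is an arbitrary set of sentences. $\omega$ is the standard model of arithmetic; "true" and "definable" mean true and definable in $\omega$ (by a formula of the language). $T$ is sound if all sentences belonging to $T$ are true in $\omega$. $T$ is incomplete if there is a sentence $\sigma$ such that $T\not\vdash\sigma$ and $T\not\vdash\neg\sigma$. $T$ is recursively axiomatizable if it has the same theorems as some theory whose set of Gödel numbers is recursive. Note that $T$ is not assumed to extend Robinson arithmetic. -}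

module Defs where

open import Data.Empty using (⊥)
open import Data.Fin.Base using (Fin; toℕ)
open import Data.Fin.Substitution using (Lift; Sub; TermSubst)
open import Data.Nat.Base using (ℕ; zero; suc; _+_; _*_; _≤_; _<_)
open import Data.Product.Base using (Σ; ∃; _×_)
open import Data.Sum.Base using (_⊎_)
open import Data.Vec.Base using (Vec; []; _∷_; lookup)
open import Data.Vec.Relation.Binary.Pointwise.Inductive using (Pointwise)
open import Function.Bundles using (_⇔_)
open import Level using (Level) renaming (suc to lsuc)
open import Relation.Binary.PropositionalEquality using (_≡_)
open import Relation.Nullary.Negation using (¬_)
open import Relation.Unary using (Pred; _∈_)

-- Syntax.  Variables are de Bruijn indices; the index of a type bounds the
-- number of free variables.

infixl 8 _+ᵗ_
infixl 9 _*ᵗ_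

data Term (n : ℕ) : Set where
  var  : Fin n → Term n
  0ᵗ   : Term n
  sᵗ   : Term n → Term n
  _+ᵗ_ : Term n → Term n → Term n
  _*ᵗ_ : Term n → Term n → Term n

infix  7 _≐_ _≤ᶠ_
infixr 5 _⇒_

data Formula (n : ℕ) : Set where
  _≐_  : Term n → Term n → Formula n
  _≤ᶠ_ : Term n → Term n → Formula n
  ⊥ᶠ   : Formula n
  _⇒_  : Formula n → Formula n → Formula n
  ∀ᶠ   : Formula (suc n) → Formula n

Sentence : Set
Sentence = Formula 0

-- ⊥, ⇒ and ∀ are a complete set of primitives for classical logic; the
-- remaining connectives are the usual abbreviations.

¬ᶠ_ : ∀ {n} → Formula n → Formula n
¬ᶠ φ = φ ⇒ ⊥ᶠ

_∧ᶠ_ : ∀ {n} → Formula n → Formula n → Formula n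
φ ∧ᶠ ψ = ¬ᶠ (φ ⇒ ¬ᶠ ψ)

_∨ᶠ_ : ∀ {n} → Formula n → Formula n → Formula n
φ ∨ᶠ ψ = ¬ᶠ φ ⇒ ψ

∃ᶠ : ∀ {n} → Formula (suc n) → Formula n
∃ᶠ φ = ¬ᶠ ∀ᶠ (¬ᶠ φ)

module TermApp {T : ℕ → Set} (l : Lift T Term) where
  open Lift l hiding (var)

  _/ᵗ_ : ∀ {m n} → Term m → Sub T m n → Term n
  var x    /ᵗ ρ = lift (lookup ρ x)
  0ᵗ       /ᵗ ρ = 0ᵗ
  sᵗ t     /ᵗ ρ = sᵗ (t /ᵗ ρ)
  (t +ᵗ u) /ᵗ ρ = (t /ᵗ ρ) +ᵗ (u /ᵗ ρ)
  (t *ᵗ u) /ᵗ ρ = (t /ᵗ ρ) *ᵗ (u /ᵗ ρ)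

termSubst : TermSubst Term
termSubst = record { var = var; app = TermApp._/ᵗ_ }

open TermSubst termSubst public using (_/_; _↑; wk; sub)

_/ᶠ_ : ∀ {m n} → Formula m → Sub Term m n → Formula n
(t ≐ u)  /ᶠ ρ = (t / ρ) ≐ (u / ρ)
(t ≤ᶠ u) /ᶠ ρ = (t / ρ) ≤ᶠ (u / ρ)
⊥ᶠ       /ᶠ ρ = ⊥ᶠ
(φ ⇒ ψ)  /ᶠ ρ = (φ /ᶠ ρ) ⇒ (ψ /ᶠ ρ)
(∀ᶠ φ)   /ᶠ ρ = ∀ᶠ (φ /ᶠ (ρ ↑))

-- Gödel numbering, by tagged iteration of Shoenfield's injective pairing
-- function (x + y)² + x + 1.

⟪_,_⟫ : ℕ → ℕ → ℕ
⟪ x , y ⟫ = suc ((x + y) * (x + y) + x)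

⌜_⌝ᵗ : ∀ {n} → Term n → ℕ
⌜ var x ⌝ᵗ  = ⟪ 0 , toℕ x ⟫
⌜ 0ᵗ ⌝ᵗ     = ⟪ 1 , 0 ⟫
⌜ sᵗ t ⌝ᵗ   = ⟪ 2 , ⌜ t ⌝ᵗ ⟫
⌜ t +ᵗ u ⌝ᵗ = ⟪ 3 , ⟪ ⌜ t ⌝ᵗ , ⌜ u ⌝ᵗ ⟫ ⟫
⌜ t *ᵗ u ⌝ᵗ = ⟪ 4 , ⟪ ⌜ t ⌝ᵗ , ⌜ u ⌝ᵗ ⟫ ⟫

⌜_⌝ : ∀ {n} → Formula n → ℕ
⌜ t ≐ u ⌝  = ⟪ 5 , ⟪ ⌜ t ⌝ᵗ , ⌜ u ⌝ᵗ ⟫ ⟫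
⌜ t ≤ᶠ u ⌝ = ⟪ 6 , ⟪ ⌜ t ⌝ᵗ , ⌜ u ⌝ᵗ ⟫ ⟫
⌜ ⊥ᶠ ⌝     = ⟪ 7 , 0 ⟫
⌜ φ ⇒ ψ ⌝  = ⟪ 8 , ⟪ ⌜ φ ⌝ , ⌜ ψ ⌝ ⟫ ⟫
⌜ ∀ᶠ φ ⌝   = ⟪ 9 , ⌜ φ ⌝ ⟫

-- Truth in the standard model.

⟦_⟧ : ∀ {n} → Term n → Vec ℕ n → ℕ
⟦ var x ⟧  ρ = lookup ρ x
⟦ 0ᵗ ⟧     ρ = 0
⟦ sᵗ t ⟧   ρ = suc (⟦ t ⟧ ρ)
⟦ t +ᵗ u ⟧ ρ = ⟦ t ⟧ ρ + ⟦ u ⟧ ρ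
⟦ t *ᵗ u ⟧ ρ = ⟦ t ⟧ ρ * ⟦ u ⟧ ρ

infix 4 ω,_⊨_

ω,_⊨_ : ∀ {n} → Vec ℕ n → Formula n → Set
ω, ρ ⊨ (t ≐ u)  = ⟦ t ⟧ ρ ≡ ⟦ u ⟧ ρ
ω, ρ ⊨ (t ≤ᶠ u) = ⟦ t ⟧ ρ ≤ ⟦ u ⟧ ρ
ω, ρ ⊨ ⊥ᶠ       = ⊥
ω, ρ ⊨ (φ ⇒ ψ)  = ω, ρ ⊨ φ → ω, ρ ⊨ ψ
ω, ρ ⊨ ∀ᶠ φ     = ∀ x → ω, x ∷ ρ ⊨ φ

True : Sentence → Set
True σ = ω, [] ⊨ σ

-- Truth is stable under double negation, because ⊥, ⇒ and ∀ preserve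
-- stability and atomic formulas are decidable.  A formula is therefore
-- compared with the double negation of P: classically this is P itself, while
-- constructively it avoids requiring every definable set to be stable.

Definable : ∀ {ℓ} → Pred ℕ ℓ → Set ℓ
Definable P = Σ (Formula 1) λ φ → ∀ n → (ω, n ∷ [] ⊨ φ) ⇔ (¬ ¬ (n ∈ P))

Theory : (ℓ : Level) → Set (lsuc ℓ)
Theory ℓ = Pred Sentence ℓ

-- Provability in classical first-order logic with equality: a Hilbert calculus
-- with modus ponens and generalization.  Since the elements of T are closed,
-- σ /ᶠ [] is just σ regarded as a formula in n variables.

infix 3 _⊢_

data _⊢_ {ℓ} (T : Theory ℓ) : ∀ {n} → Formula n → Set ℓ where
  hyp    : ∀ {n} {σ : Sentence} → σ ∈ T → _⊢_ T {n} (σ /ᶠ [])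
  mp     : ∀ {n} {φ ψ : Formula n} → T ⊢ φ ⇒ ψ → T ⊢ φ → T ⊢ ψ
  gen    : ∀ {n} {φ : Formula (suc n)} → T ⊢ φ → T ⊢ ∀ᶠ φ
  ax-K   : ∀ {n} (φ ψ : Formula n) → T ⊢ φ ⇒ ψ ⇒ φ
  ax-S   : ∀ {n} (φ ψ χ : Formula n) →
           T ⊢ (φ ⇒ ψ ⇒ χ) ⇒ (φ ⇒ ψ) ⇒ φ ⇒ χ
  ax-DN  : ∀ {n} (φ : Formula n) → T ⊢ (¬ᶠ ¬ᶠ φ) ⇒ φ
  ax-∀E  : ∀ {n} (φ : Formula (suc n)) (t : Term n) → T ⊢ ∀ᶠ φ ⇒ φ /ᶠ sub t
  ax-∀I  : ∀ {n} (φ : Formula n) (ψ : Formula (suc n)) →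
           T ⊢ ∀ᶠ ((φ /ᶠ wk) ⇒ ψ) ⇒ φ ⇒ ∀ᶠ ψ
  ax-≐   : ∀ {n} (t : Term n) → T ⊢ t ≐ t
  ax-sub : ∀ {n} (φ : Formula (suc n)) (t u : Term n) →
           T ⊢ t ≐ u ⇒ φ /ᶠ sub t ⇒ φ /ᶠ sub u

Pr : ∀ {ℓ} → Theory ℓ → Pred ℕ ℓ
Pr T n = Σ Sentence λ σ → ⌜ σ ⌝ ≡ n × T ⊢ σ

Sound : ∀ {ℓ} → Theory ℓ → Set ℓ
Sound T = ∀ σ → σ ∈ T → True σ

Incomplete : ∀ {ℓ} → Theory ℓ → Set ℓ
Incomplete T = Σ Sentence λ σ → ¬ (T ⊢ σ) × ¬ (T ⊢ ¬ᶠ σ)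

-- Kleene's partial recursive functions and their evaluation relation.  The
-- recursion or search variable is the first argument.

data Rec : ℕ → Set where
  zeroʳ : ∀ {n} → Rec n
  sucʳ  : Rec 1
  proj  : ∀ {n} → Fin n → Rec n
  comp  : ∀ {m n} → Rec m → Vec (Rec n) m → Rec n
  prec  : ∀ {n} → Rec n → Rec (suc (suc n)) → Rec (suc n)
  μ     : ∀ {n} → Rec (suc n) → Rec n

infix 4 _∙_⇓_

data _∙_⇓_ : ∀ {n} → Rec n → Vec ℕ n → ℕ → Set where
  ⇓zero   : ∀ {n} {xs : Vec ℕ n} → zeroʳ ∙ xs ⇓ 0
  ⇓suc    : ∀ {x} → sucʳ ∙ x ∷ [] ⇓ suc x
  ⇓proj   : ∀ {n} {xs : Vec ℕ n} (i : Fin n) → proj i ∙ xs ⇓ lookup xs i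
  ⇓comp   : ∀ {m n} {f : Rec m} {gs : Vec (Rec n) m} {xs ys z} →
            Pointwise (λ g y → g ∙ xs ⇓ y) gs ys → f ∙ ys ⇓ z →
            comp f gs ∙ xs ⇓ z
  ⇓prec-0 : ∀ {n} {f : Rec n} {g xs y} →
            f ∙ xs ⇓ y → prec f g ∙ zero ∷ xs ⇓ y
  ⇓prec-s : ∀ {n} {f : Rec n} {g k xs y z} →
            prec f g ∙ k ∷ xs ⇓ y → g ∙ k ∷ y ∷ xs ⇓ z →
            prec f g ∙ suc k ∷ xs ⇓ z
  ⇓μ      : ∀ {n} {f : Rec (suc n)} {xs y} →
            f ∙ y ∷ xs ⇓ 0 →
            (∀ z → z < y → ∃ λ w → f ∙ z ∷ xs ⇓ suc w) →
            μ f ∙ xs ⇓ y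

-- The characteristic function of P is (total) recursive.

Recursive : ∀ {ℓ} → Pred ℕ ℓ → Set ℓ
Recursive P = Σ (Rec 1) λ f → ∀ n →
  (n ∈ P × f ∙ n ∷ [] ⇓ 1) ⊎ (¬ (n ∈ P) × f ∙ n ∷ [] ⇓ 0)

GödelNumbers : ∀ {ℓ} → Theory ℓ → Pred ℕ ℓ
GödelNumbers T n = Σ Sentence λ σ → ⌜ σ ⌝ ≡ n × σ ∈ T

RecursivelyAxiomatizable : ∀ {ℓ} → Theory ℓ → Set (lsuc ℓ)
RecursivelyAxiomatizable {ℓ} T = Σ (Theory ℓ) λ T′ →
  Recursive (GödelNumbers T′) × (∀ (σ : Sentence) → (T ⊢ σ) ⇔ (T′ ⊢ σ))

module Submission where

open import Defs
open import Data.Fin.Base using (Fin; zero; suc; toℕ; fromℕ<; _↑ʳ_)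
open import Data.Fin.Patterns using (0F; 1F; 2F; 3F; 4F; 5F; 6F; 7F; 8F)
open import Data.Fin.Properties using (toℕ-injective; toℕ<n; toℕ-fromℕ<)
open import Data.Fin.Substitution using (Lift; Sub; TermSubst; module VarSubst)
open import Data.Fin.Substitution.Lemmas using (Lemmas₁; module VarLemmas)
open import Data.List.Base using (List; []; _∷_) renaming (map to mapᴸ; _++_ to _++ᴸ_)
open import Data.List.Membership.Propositional using () renaming (_∈_ to _∈ᴸ_)
open import Data.List.Membership.Propositional.Properties using (∈-++⁻; ∈-map⁺)
open import Data.List.Relation.Binary.Subset.Propositional using () renaming (_⊆_ to _⊆ᴸ_)
open import Data.List.Relation.Binary.Subset.Propositional.Properties
  using (xs⊆xs++ys; xs⊆ys++xs)
open import Data.List.Relation.Unary.Any using (here; there)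
open import Data.Nat.Base using (ℕ; zero; suc; _+_; _*_; _∸_; _≤_; _<_; z≤n; s≤s; s≤s⁻¹; _!)
open import Data.Nat.Coprimality using (Coprime; coprime-divisor) renaming (sym to coprime-sym)
open import Data.Nat.Divisibility
  using (_∣_; divides; ∣-refl; ∣-trans; ∣1⇒≡1; ∣m+n∣m⇒∣n; m∣m*n; ∣n⇒∣m*n; m≤n⇒m!∣n!)
open import Data.Nat.Induction using (<-rec)
open import Data.Nat.ListAction using (sum; product)
open import Data.Nat.ListAction.Properties using (∈⇒∣product)
open import Data.Nat.Properties
open import Data.Product.Base using (Σ; ∃; _×_; _,_; proj₁; proj₂)
open import Data.Sum.Base using (_⊎_; inj₁; inj₂)
open import Data.Vec.Base using (Vec; []; _∷_; lookup; map; _++_; drop; tabulate)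
open import Data.Vec.Properties using (lookup-map; lookup∘tabulate)
open import Data.Vec.Relation.Binary.Pointwise.Inductive using (Pointwise; []; _∷_)
open import Function.Base using (_∘_; id)
open import Function.Bundles using (_⇔_; mk⇔; Equivalence)
open import Relation.Binary.Definitions using (tri<; tri≈; tri>)
open import Relation.Binary.PropositionalEquality
open import Relation.Nullary.Decidable using (decidable-stable; yes; no)
open import Relation.Nullary.Negation using (¬_; contradiction)
open import Relation.Unary using (_∈_)

open Equivalence using (to; from)

-- Incompleteness: let γ be true iff it is not provable in the sound theory T.  A
-- proof of γ would make γ true, hence unprovable; so γ is unprovable, hence true,
-- and ¬ γ is unprovable as well.
--
-- Definability of provability: every finitary inductive definition with
-- definable axioms and two-premise rules has a definable closure, because a
-- derivation is a finite set of ranked numbers and finite sets are coded by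
-- divisibility.  The graphs of recursive functions, numerals, substitution and
-- provability are all obtained as such closures on codes.  Existential
-- statements are translated to ¬ ∀ ¬, so a formula defines a predicate up to
-- double negation.

-- Nothing is known about what `T` can prove, so no step is carried out inside `T`: the fixed point
-- and all definability results concern truth in the standard model. A code does not record how many
-- variables its formula may have, since `var` contributes only its index. Codes are therefore
-- injective only for a fixed number of variables, and substitution and provability carry that
-- number along with the code. Inductive closures take the place of sequence coding: a recursive
-- definition becomes a closed set of input-output pairs, so numbers have to be coded as sets only
-- once.

module T = TermSubst termSubst

lemmas₁ : Lemmas₁ Term
lemmas₁ = record
  { lemmas₀ = record { simple = T.simple }
  ; weaken-var = λ {_} {x} → cong var (VarLemmas.lookup-wk x)
  }

open Lemmas₁ lemmas₁ using (weaken-var; lookup-id; lookup-wk)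

-- Semantics of substitution and injectivity of codes

⊨-stable : ∀ {n} (φ : Formula n) {ρ} → ¬ ¬ (ω, ρ ⊨ φ) → ω, ρ ⊨ φ
⊨-stable (t ≐ u)  {ρ} h = decidable-stable (⟦ t ⟧ ρ ≟ ⟦ u ⟧ ρ) h
⊨-stable (t ≤ᶠ u) {ρ} h = decidable-stable (⟦ t ⟧ ρ ≤? ⟦ u ⟧ ρ) h
⊨-stable ⊥ᶠ       h = h id
⊨-stable (φ ⇒ ψ)  h a = ⊨-stable ψ λ k → h λ f → k (f a)
⊨-stable (∀ᶠ φ)   h x = ⊨-stable φ λ k → h λ f → k (f x)

-- Kept general in the `Lift` because weakening of terms is a substitution of variables, while `_/_`
-- substitutes terms; both are instances.
⟦⟧-/ᵗ : ∀ {T m n} (l : Lift T Term) (t : Term m) {σ : Sub T m n} {ρ ρ′} →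
  (∀ i → ⟦ Lift.lift l (lookup σ i) ⟧ ρ ≡ lookup ρ′ i) →
  ⟦ TermApp._/ᵗ_ l t σ ⟧ ρ ≡ ⟦ t ⟧ ρ′
⟦⟧-/ᵗ l (var x)  h = h x
⟦⟧-/ᵗ l 0ᵗ       h = refl
⟦⟧-/ᵗ l (sᵗ t)   h = cong suc (⟦⟧-/ᵗ l t h)
⟦⟧-/ᵗ l (t +ᵗ u) h = cong₂ _+_ (⟦⟧-/ᵗ l t h) (⟦⟧-/ᵗ l u h)
⟦⟧-/ᵗ l (t *ᵗ u) h = cong₂ _*_ (⟦⟧-/ᵗ l t h) (⟦⟧-/ᵗ l u h)

⟦⟧-weaken : ∀ {n} (t : Term n) {x ρ} → ⟦ T.weaken t ⟧ (x ∷ ρ) ≡ ⟦ t ⟧ ρ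
⟦⟧-weaken t {x} {ρ} = ⟦⟧-/ᵗ T.varLift t λ i → cong (lookup (x ∷ ρ)) (VarLemmas.lookup-wk i)

infix 4 _⊨ˢ_≈_

_⊨ˢ_≈_ : ∀ {m n} → Vec ℕ n → Sub Term m n → Vec ℕ m → Set
ρ ⊨ˢ σ ≈ ρ′ = ∀ i → ⟦ lookup σ i ⟧ ρ ≡ lookup ρ′ i

⟦⟧-/ : ∀ {m n} (t : Term m) {ρ} {σ : Sub Term m n} {ρ′} → ρ ⊨ˢ σ ≈ ρ′ →
  ⟦ t / σ ⟧ ρ ≡ ⟦ t ⟧ ρ′
⟦⟧-/ t = ⟦⟧-/ᵗ T.termLift t

≡⇒⇔ : ∀ (_∼_ : ℕ → ℕ → Set) {x x′ y y′} → x ≡ x′ → y ≡ y′ → (x ∼ y) ⇔ (x′ ∼ y′)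
≡⇒⇔ _∼_ refl refl = mk⇔ id id

↑-≈ : ∀ {m n} {ρ} {σ : Sub Term m n} {ρ′ x} → ρ ⊨ˢ σ ≈ ρ′ → x ∷ ρ ⊨ˢ σ ↑ ≈ x ∷ ρ′
↑-≈ h zero = refl
↑-≈ {ρ = ρ} {σ} {ρ′} {x} h (suc i) = begin
  ⟦ lookup (map T.weaken σ) i ⟧ (x ∷ ρ) ≡⟨ cong (λ t → ⟦ t ⟧ (x ∷ ρ)) (lookup-map i T.weaken σ) ⟩
  ⟦ T.weaken (lookup σ i) ⟧ (x ∷ ρ)     ≡⟨ ⟦⟧-weaken (lookup σ i) ⟩
  ⟦ lookup σ i ⟧ ρ                      ≡⟨ h i ⟩
  lookup ρ′ i                           ∎
  where open ≡-Reasoning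

⊨-/ᶠ : ∀ {m n} (φ : Formula m) {ρ} {σ : Sub Term m n} {ρ′} → ρ ⊨ˢ σ ≈ ρ′ →
  ω, ρ ⊨ (φ /ᶠ σ) ⇔ ω, ρ′ ⊨ φ
⊨-/ᶠ (t ≐ u) h = ≡⇒⇔ _≡_ (⟦⟧-/ t h) (⟦⟧-/ u h)
⊨-/ᶠ (t ≤ᶠ u) h = ≡⇒⇔ _≤_ (⟦⟧-/ t h) (⟦⟧-/ u h)
⊨-/ᶠ ⊥ᶠ h = mk⇔ id id
⊨-/ᶠ (φ ⇒ ψ) h = mk⇔
  (λ f a → to (⊨-/ᶠ ψ h) (f (from (⊨-/ᶠ φ h) a)))
  (λ f a → from (⊨-/ᶠ ψ h) (f (to (⊨-/ᶠ φ h) a)))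
⊨-/ᶠ (∀ᶠ φ) {σ = σ} h = mk⇔
  (λ f x → to (⊨-/ᶠ φ (↑-≈ {σ = σ} h)) (f x))
  (λ f x → from (⊨-/ᶠ φ (↑-≈ {σ = σ} h)) (f x))

wk-≈ : ∀ {n} {ρ : Vec ℕ n} {x} → x ∷ ρ ⊨ˢ wk ≈ ρ
wk-≈ {ρ = ρ} {x} i = cong (λ t → ⟦ t ⟧ (x ∷ ρ)) (lookup-wk i)

sub-≈ : ∀ {n} {ρ : Vec ℕ n} (t : Term n) → ρ ⊨ˢ sub t ≈ ⟦ t ⟧ ρ ∷ ρ
sub-≈ t zero = refl
sub-≈ {ρ = ρ} t (suc i) = cong (λ t → ⟦ t ⟧ ρ) (lookup-id i)

⊢-sound : ∀ {ℓ} {T : Theory ℓ} → Sound T → ∀ {n} {φ : Formula n} → T ⊢ φ → ∀ ρ → ω, ρ ⊨ φ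
⊢-sound s (hyp {σ = σ} σ∈T) ρ = from (⊨-/ᶠ σ (λ ())) (s σ σ∈T)
⊢-sound s (mp d e) ρ = ⊢-sound s d ρ (⊢-sound s e ρ)
⊢-sound s (gen d) ρ x = ⊢-sound s d (x ∷ ρ)
⊢-sound s (ax-K φ ψ) ρ a b = a
⊢-sound s (ax-S φ ψ χ) ρ f g a = f a (g a)
⊢-sound s (ax-DN φ) ρ h = ⊨-stable φ h
⊢-sound s (ax-∀E φ t) ρ f = from (⊨-/ᶠ φ (sub-≈ t)) (f (⟦ t ⟧ ρ))
⊢-sound s (ax-∀I φ ψ) ρ f a x = f x (from (⊨-/ᶠ φ wk-≈) a)
⊢-sound s (ax-≐ t) ρ = refl
⊢-sound s (ax-sub φ t u) ρ eq a =
  from (⊨-/ᶠ φ (sub-≈ u)) (subst (λ x → ω, x ∷ ρ ⊨ φ) eq (to (⊨-/ᶠ φ (sub-≈ t)) a))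

-- Opacity keeps the squares in ⟪_,_⟫ from being multiplied out when codes with
-- numerical tags are compared.
opaque
  infixr 6 _⨾_

  _⨾_ : ℕ → ℕ → ℕ
  _⨾_ = ⟪_,_⟫

  ⨾≡⟪⟫ : ∀ k {x x′} → x ≡ x′ → k ⨾ x ≡ ⟪ k , x′ ⟫
  ⨾≡⟪⟫ k refl = refl

  ⨾⨾≡⟪⟪⟫⟫ : ∀ k {x x′ y y′} → x ≡ x′ → y ≡ y′ → k ⨾ x ⨾ y ≡ ⟪ k , ⟪ x′ , y′ ⟫ ⟫
  ⨾⨾≡⟪⟪⟫⟫ k refl refl = refl

-- With s = x + y, the number s² + x lies below (s + 1)², so the code determines the square and
-- hence s.
⟪⟫-sum-≤ : ∀ x y x′ y′ → ⟪ x , y ⟫ ≡ ⟪ x′ , y′ ⟫ → x + y ≤ x′ + y′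
⟪⟫-sum-≤ x y x′ y′ eq = ≮⇒≥ λ s′<s → <-irrefl refl (begin-strict
  s′ * s′ + x′        ≤⟨ +-monoʳ-≤ (s′ * s′) (m≤m+n x′ y′) ⟩
  s′ * s′ + s′        ≡⟨ +-comm (s′ * s′) s′ ⟩
  suc s′ * s′         <⟨ *-monoʳ-< (suc s′) (n<1+n s′) ⟩
  suc s′ * suc s′     ≤⟨ *-mono-≤ s′<s s′<s ⟩
  s * s               ≤⟨ m≤m+n (s * s) x ⟩
  s * s + x           ≡⟨ suc-injective eq ⟩
  s′ * s′ + x′        ∎)
  where
  open ≤-Reasoning
  s = x + y
  s′ = x′ + y′

⟪⟫-injective : ∀ x y x′ y′ → ⟪ x , y ⟫ ≡ ⟪ x′ , y′ ⟫ → x ≡ x′ × y ≡ y′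
⟪⟫-injective x y x′ y′ eq = x≡x′ , y≡y′
  where
  s≡s′ : x + y ≡ x′ + y′
  s≡s′ = ≤-antisym (⟪⟫-sum-≤ x y x′ y′ eq) (⟪⟫-sum-≤ x′ y′ x y (sym eq))
  x≡x′ : x ≡ x′
  x≡x′ = +-cancelˡ-≡ ((x′ + y′) * (x′ + y′)) x x′
    (subst (λ s → s * s + x ≡ (x′ + y′) * (x′ + y′) + x′) s≡s′ (suc-injective eq))
  y≡y′ : y ≡ y′
  y≡y′ = +-cancelˡ-≡ x′ y y′ (subst (λ z → z + y ≡ x′ + y′) x≡x′ s≡s′)

opaque
  unfolding _⨾_

  ⨾-injective : ∀ {x y x′ y′} → x ⨾ y ≡ x′ ⨾ y′ → x ≡ x′ × y ≡ y′
  ⨾-injective {x} {y} {x′} {y′} = ⟪⟫-injective x y x′ y′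

⨾-injectiveˡ : ∀ {x y x′ y′} → x ⨾ y ≡ x′ ⨾ y′ → x ≡ x′
⨾-injectiveˡ eq = proj₁ (⨾-injective eq)

⨾-injectiveʳ : ∀ {x y x′ y′} → x ⨾ y ≡ x′ ⨾ y′ → y ≡ y′
⨾-injectiveʳ eq = proj₂ (⨾-injective eq)

-- The Gödel numbering rebuilt on the opaque pairing; `codeᵗ-⌜⌝` and `code-⌜⌝` lead back to the
-- original.
codeᵗ : ∀ {n} → Term n → ℕ
codeᵗ (var x)  = 0 ⨾ toℕ x
codeᵗ 0ᵗ       = 1 ⨾ 0
codeᵗ (sᵗ t)   = 2 ⨾ codeᵗ t
codeᵗ (t +ᵗ u) = 3 ⨾ codeᵗ t ⨾ codeᵗ u
codeᵗ (t *ᵗ u) = 4 ⨾ codeᵗ t ⨾ codeᵗ u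

code : ∀ {n} → Formula n → ℕ
code (t ≐ u)  = 5 ⨾ codeᵗ t ⨾ codeᵗ u
code (t ≤ᶠ u) = 6 ⨾ codeᵗ t ⨾ codeᵗ u
code ⊥ᶠ       = 7 ⨾ 0
code (φ ⇒ ψ)  = 8 ⨾ code φ ⨾ code ψ
code (∀ᶠ φ)   = 9 ⨾ code φ

codeᵗ-⌜⌝ : ∀ {n} (t : Term n) → codeᵗ t ≡ ⌜ t ⌝ᵗ
codeᵗ-⌜⌝ (var x)  = ⨾≡⟪⟫ 0 refl
codeᵗ-⌜⌝ 0ᵗ       = ⨾≡⟪⟫ 1 refl
codeᵗ-⌜⌝ (sᵗ t)   = ⨾≡⟪⟫ 2 (codeᵗ-⌜⌝ t)
codeᵗ-⌜⌝ (t +ᵗ u) = ⨾⨾≡⟪⟪⟫⟫ 3 (codeᵗ-⌜⌝ t) (codeᵗ-⌜⌝ u)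
codeᵗ-⌜⌝ (t *ᵗ u) = ⨾⨾≡⟪⟪⟫⟫ 4 (codeᵗ-⌜⌝ t) (codeᵗ-⌜⌝ u)

code-⌜⌝ : ∀ {n} (φ : Formula n) → code φ ≡ ⌜ φ ⌝
code-⌜⌝ (t ≐ u)  = ⨾⨾≡⟪⟪⟫⟫ 5 (codeᵗ-⌜⌝ t) (codeᵗ-⌜⌝ u)
code-⌜⌝ (t ≤ᶠ u) = ⨾⨾≡⟪⟪⟫⟫ 6 (codeᵗ-⌜⌝ t) (codeᵗ-⌜⌝ u)
code-⌜⌝ ⊥ᶠ       = ⨾≡⟪⟫ 7 refl
code-⌜⌝ (φ ⇒ ψ)  = ⨾⨾≡⟪⟪⟫⟫ 8 (code-⌜⌝ φ) (code-⌜⌝ ψ)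
code-⌜⌝ (∀ᶠ φ)   = ⨾≡⟪⟫ 9 (code-⌜⌝ φ)

tag-clash : ∀ {x y x′ y′} {A : Set} → ¬ x ≡ x′ → x ⨾ y ≡ x′ ⨾ y′ → A
tag-clash x≢x′ eq = contradiction (⨾-injectiveˡ eq) x≢x′

binary-injective : ∀ {k a b a′ b′} → k ⨾ a ⨾ b ≡ k ⨾ a′ ⨾ b′ → a ≡ a′ × b ≡ b′
binary-injective eq = ⨾-injective (⨾-injectiveʳ eq)

codeᵗ-injective : ∀ {n} (t u : Term n) → codeᵗ t ≡ codeᵗ u → t ≡ u
codeᵗ-injective (var x) (var y) eq = cong var (toℕ-injective (⨾-injectiveʳ eq))
codeᵗ-injective 0ᵗ 0ᵗ eq = refl
codeᵗ-injective (sᵗ t) (sᵗ u) eq = cong sᵗ (codeᵗ-injective t u (⨾-injectiveʳ eq))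
codeᵗ-injective (t +ᵗ t′) (u +ᵗ u′) eq with binary-injective eq
... | p , q = cong₂ _+ᵗ_ (codeᵗ-injective t u p) (codeᵗ-injective t′ u′ q)
codeᵗ-injective (t *ᵗ t′) (u *ᵗ u′) eq with binary-injective eq
... | p , q = cong₂ _*ᵗ_ (codeᵗ-injective t u p) (codeᵗ-injective t′ u′ q)
codeᵗ-injective (var _) 0ᵗ eq = tag-clash (λ ()) eq
codeᵗ-injective (var _) (sᵗ _) eq = tag-clash (λ ()) eq
codeᵗ-injective (var _) (_ +ᵗ _) eq = tag-clash (λ ()) eq
codeᵗ-injective (var _) (_ *ᵗ _) eq = tag-clash (λ ()) eq
codeᵗ-injective 0ᵗ (var _) eq = tag-clash (λ ()) eq
codeᵗ-injective 0ᵗ (sᵗ _) eq = tag-clash (λ ()) eq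
codeᵗ-injective 0ᵗ (_ +ᵗ _) eq = tag-clash (λ ()) eq
codeᵗ-injective 0ᵗ (_ *ᵗ _) eq = tag-clash (λ ()) eq
codeᵗ-injective (sᵗ _) (var _) eq = tag-clash (λ ()) eq
codeᵗ-injective (sᵗ _) 0ᵗ eq = tag-clash (λ ()) eq
codeᵗ-injective (sᵗ _) (_ +ᵗ _) eq = tag-clash (λ ()) eq
codeᵗ-injective (sᵗ _) (_ *ᵗ _) eq = tag-clash (λ ()) eq
codeᵗ-injective (_ +ᵗ _) (var _) eq = tag-clash (λ ()) eq
codeᵗ-injective (_ +ᵗ _) 0ᵗ eq = tag-clash (λ ()) eq
codeᵗ-injective (_ +ᵗ _) (sᵗ _) eq = tag-clash (λ ()) eq
codeᵗ-injective (_ +ᵗ _) (_ *ᵗ _) eq = tag-clash (λ ()) eq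
codeᵗ-injective (_ *ᵗ _) (var _) eq = tag-clash (λ ()) eq
codeᵗ-injective (_ *ᵗ _) 0ᵗ eq = tag-clash (λ ()) eq
codeᵗ-injective (_ *ᵗ _) (sᵗ _) eq = tag-clash (λ ()) eq
codeᵗ-injective (_ *ᵗ _) (_ +ᵗ _) eq = tag-clash (λ ()) eq

code-injective : ∀ {n} (φ ψ : Formula n) → code φ ≡ code ψ → φ ≡ ψ
code-injective (t ≐ t′) (u ≐ u′) eq with binary-injective eq
... | p , q = cong₂ _≐_ (codeᵗ-injective t u p) (codeᵗ-injective t′ u′ q)
code-injective (t ≤ᶠ t′) (u ≤ᶠ u′) eq with binary-injective eq
... | p , q = cong₂ _≤ᶠ_ (codeᵗ-injective t u p) (codeᵗ-injective t′ u′ q)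
code-injective ⊥ᶠ ⊥ᶠ eq = refl
code-injective (φ ⇒ φ′) (ψ ⇒ ψ′) eq with binary-injective eq
... | p , q = cong₂ _⇒_ (code-injective φ ψ p) (code-injective φ′ ψ′ q)
code-injective (∀ᶠ φ) (∀ᶠ ψ) eq = cong ∀ᶠ (code-injective φ ψ (⨾-injectiveʳ eq))
code-injective (_ ≐ _) (_ ≤ᶠ _) eq = tag-clash (λ ()) eq
code-injective (_ ≐ _) ⊥ᶠ eq = tag-clash (λ ()) eq
code-injective (_ ≐ _) (_ ⇒ _) eq = tag-clash (λ ()) eq
code-injective (_ ≐ _) (∀ᶠ _) eq = tag-clash (λ ()) eq
code-injective (_ ≤ᶠ _) (_ ≐ _) eq = tag-clash (λ ()) eq
code-injective (_ ≤ᶠ _) ⊥ᶠ eq = tag-clash (λ ()) eq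
code-injective (_ ≤ᶠ _) (_ ⇒ _) eq = tag-clash (λ ()) eq
code-injective (_ ≤ᶠ _) (∀ᶠ _) eq = tag-clash (λ ()) eq
code-injective ⊥ᶠ (_ ≐ _) eq = tag-clash (λ ()) eq
code-injective ⊥ᶠ (_ ≤ᶠ _) eq = tag-clash (λ ()) eq
code-injective ⊥ᶠ (_ ⇒ _) eq = tag-clash (λ ()) eq
code-injective ⊥ᶠ (∀ᶠ _) eq = tag-clash (λ ()) eq
code-injective (_ ⇒ _) (_ ≐ _) eq = tag-clash (λ ()) eq
code-injective (_ ⇒ _) (_ ≤ᶠ _) eq = tag-clash (λ ()) eq
code-injective (_ ⇒ _) ⊥ᶠ eq = tag-clash (λ ()) eq
code-injective (_ ⇒ _) (∀ᶠ _) eq = tag-clash (λ ()) eq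
code-injective (∀ᶠ _) (_ ≐ _) eq = tag-clash (λ ()) eq
code-injective (∀ᶠ _) (_ ≤ᶠ _) eq = tag-clash (λ ()) eq
code-injective (∀ᶠ _) ⊥ᶠ eq = tag-clash (λ ()) eq
code-injective (∀ᶠ _) (_ ⇒ _) eq = tag-clash (λ ()) eq

-- Definable relations

infixl 8 _⊕_
infixl 9 _⊗_
infixr 7 _⨾ᵉ_

data Exp (n : ℕ) : Set where
  #_   : Fin n → Exp n
  lit  : ℕ → Exp n
  _⊕_  : Exp n → Exp n → Exp n
  _⊗_  : Exp n → Exp n → Exp n
  _⨾ᵉ_ : Exp n → Exp n → Exp n
  sucᵉ : Exp n → Exp n

⟦_⟧ᵉ : ∀ {n} → Exp n → Vec ℕ n → ℕ
⟦ # i ⟧ᵉ    ρ = lookup ρ i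
⟦ lit k ⟧ᵉ  ρ = k
⟦ sucᵉ e ⟧ᵉ ρ = suc (⟦ e ⟧ᵉ ρ)
⟦ e ⊕ f ⟧ᵉ  ρ = ⟦ e ⟧ᵉ ρ + ⟦ f ⟧ᵉ ρ
⟦ e ⊗ f ⟧ᵉ  ρ = ⟦ e ⟧ᵉ ρ * ⟦ f ⟧ᵉ ρ
⟦ e ⨾ᵉ f ⟧ᵉ ρ = ⟦ e ⟧ᵉ ρ ⨾ ⟦ f ⟧ᵉ ρ

numeral : ∀ {n} → ℕ → Term n
numeral zero    = 0ᵗ
numeral (suc k) = sᵗ (numeral k)

⟦numeral⟧ : ∀ {n} k (ρ : Vec ℕ n) → ⟦ numeral k ⟧ ρ ≡ k
⟦numeral⟧ zero    ρ = refl
⟦numeral⟧ (suc k) ρ = cong suc (⟦numeral⟧ k ρ)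

pairᵗ : ∀ {n} → Term n → Term n → Term n
pairᵗ t u = sᵗ ((t +ᵗ u) *ᵗ (t +ᵗ u) +ᵗ t)

opaque
  unfolding _⨾_

  ⟦pairᵗ⟧ : ∀ {n} (t u : Term n) ρ → ⟦ pairᵗ t u ⟧ ρ ≡ ⟦ t ⟧ ρ ⨾ ⟦ u ⟧ ρ
  ⟦pairᵗ⟧ t u ρ = refl

term : ∀ {n} → Exp n → Term n
term (# i)    = var i
term (lit k)  = numeral k
term (sucᵉ e) = sᵗ (term e)
term (e ⊕ f)  = term e +ᵗ term f
term (e ⊗ f)  = term e *ᵗ term f
term (e ⨾ᵉ f) = pairᵗ (term e) (term f)

⟦term⟧ : ∀ {n} (e : Exp n) ρ → ⟦ term e ⟧ ρ ≡ ⟦ e ⟧ᵉ ρ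
⟦term⟧ (# i)    ρ = refl
⟦term⟧ (lit k)  ρ = ⟦numeral⟧ k ρ
⟦term⟧ (sucᵉ e) ρ = cong suc (⟦term⟧ e ρ)
⟦term⟧ (e ⊕ f)  ρ = cong₂ _+_ (⟦term⟧ e ρ) (⟦term⟧ f ρ)
⟦term⟧ (e ⊗ f)  ρ = cong₂ _*_ (⟦term⟧ e ρ) (⟦term⟧ f ρ)
⟦term⟧ (e ⨾ᵉ f) ρ = trans (⟦pairᵗ⟧ (term e) (term f) ρ) (cong₂ _⨾_ (⟦term⟧ e ρ) (⟦term⟧ f ρ))

record Def {n} (P : Vec ℕ n → Set) : Set where
  constructor def
  field
    formula : Formula n
    correct : ∀ ρ → (ω, ρ ⊨ formula) ⇔ (¬ ¬ P ρ)

open Def public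

-- The formula stays the same. One direction may end in a double negation, which is all that
-- `closure` can offer when it reads a derivation off its code.
def-≈ : ∀ {n} {P Q : Vec ℕ n → Set} →
  (∀ {ρ} → P ρ → ¬ ¬ Q ρ) → (∀ {ρ} → Q ρ → P ρ) → Def P → Def Q
def-≈ f g d = def (formula d) λ ρ → mk⇔
  (λ h ¬q → to (correct d ρ) h λ p → f p ¬q)
  (λ h → from (correct d ρ) λ ¬p → h (¬p ∘ g))

def-⇔ : ∀ {n} {P Q : Vec ℕ n → Set} →
  (∀ {ρ} → P ρ → Q ρ) → (∀ {ρ} → Q ρ → P ρ) → Def P → Def Q
def-⇔ f = def-≈ λ p ¬q → ¬q (f p)

-- A double negation cannot be moved out of a universal quantifier constructively, so the consequent
-- keeps its own. `Pos` has no universal quantifier; this one enters through `rel` in `derivationᵖ`.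
def-∀⇒ : ∀ {n} {P Q : Vec ℕ (suc n) → Set} → Def P → Def Q →
  Def (λ ρ → ∀ x → P (x ∷ ρ) → ¬ ¬ Q (x ∷ ρ))
def-∀⇒ p q = def (∀ᶠ (formula p ⇒ formula q)) λ ρ → mk⇔
  (λ h ¬f → ¬f λ x px → to (correct q (x ∷ ρ)) (h x (from (correct p (x ∷ ρ)) λ k → k px)))
  (λ h x a → from (correct q (x ∷ ρ)) λ ¬q →
    h λ f → to (correct p (x ∷ ρ)) a λ px → f x px ¬q)

infix  6 _≐ᵖ_ _≤ᵖ_
infixr 5 _∧ᵖ_
infixr 4 _∨ᵖ_

-- rel k d es applies the relation defined by d to the values of es, followed by
-- the environment without its first k entries.
data Pos : ℕ → Set₁ where
  _≐ᵖ_ : ∀ {n} → Exp n → Exp n → Pos n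
  _≤ᵖ_ : ∀ {n} → Exp n → Exp n → Pos n
  _∧ᵖ_ : ∀ {n} → Pos n → Pos n → Pos n
  _∨ᵖ_ : ∀ {n} → Pos n → Pos n → Pos n
  ∃ᵖ   : ∀ {n} → Pos (suc n) → Pos n
  rel  : ∀ k {m n} {P : Vec ℕ (m + n) → Set} → Def P → Vec (Exp (k + n)) m → Pos (k + n)

⟦_⟧ᵖ : ∀ {n} → Pos n → Vec ℕ n → Set
⟦ e ≐ᵖ f ⟧ᵖ ρ = ⟦ e ⟧ᵉ ρ ≡ ⟦ f ⟧ᵉ ρ
⟦ e ≤ᵖ f ⟧ᵖ ρ = ⟦ e ⟧ᵉ ρ ≤ ⟦ f ⟧ᵉ ρ
⟦ φ ∧ᵖ ψ ⟧ᵖ ρ = ⟦ φ ⟧ᵖ ρ × ⟦ ψ ⟧ᵖ ρ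
⟦ φ ∨ᵖ ψ ⟧ᵖ ρ = ⟦ φ ⟧ᵖ ρ ⊎ ⟦ ψ ⟧ᵖ ρ
⟦ ∃ᵖ φ ⟧ᵖ   ρ = ∃ λ x → ⟦ φ ⟧ᵖ (x ∷ ρ)
⟦ rel k {P = P} d es ⟧ᵖ ρ = P (map (λ e → ⟦ e ⟧ᵉ ρ) es ++ drop k ρ)

arguments : ∀ k {m n} → Vec (Exp (k + n)) m → Sub Term (m + n) (k + n)
arguments k es = map term es ++ tabulate (λ i → var (k ↑ʳ i))

lookup-drop : ∀ {A : Set} k {n} (xs : Vec A (k + n)) i → lookup xs (k ↑ʳ i) ≡ lookup (drop k xs) i
lookup-drop zero    xs       i = refl
lookup-drop (suc k) (x ∷ xs) i = lookup-drop k xs i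

arguments-≈ : ∀ k {m n} (es : Vec (Exp (k + n)) m) ρ →
  ρ ⊨ˢ arguments k es ≈ map (λ e → ⟦ e ⟧ᵉ ρ) es ++ drop k ρ
arguments-≈ k [] ρ i =
  trans (cong (λ t → ⟦ t ⟧ ρ) (lookup∘tabulate (λ i → var (k ↑ʳ i)) i)) (lookup-drop k ρ i)
arguments-≈ k (e ∷ es) ρ zero    = ⟦term⟧ e ρ
arguments-≈ k (e ∷ es) ρ (suc i) = arguments-≈ k es ρ i

⌊_⌋ : ∀ {n} → Pos n → Formula n
⌊ e ≐ᵖ f ⌋     = term e ≐ term f
⌊ e ≤ᵖ f ⌋     = term e ≤ᶠ term f
⌊ φ ∧ᵖ ψ ⌋     = ⌊ φ ⌋ ∧ᶠ ⌊ ψ ⌋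
⌊ φ ∨ᵖ ψ ⌋     = ⌊ φ ⌋ ∨ᶠ ⌊ ψ ⌋
⌊ ∃ᵖ φ ⌋       = ∃ᶠ ⌊ φ ⌋
⌊ rel k d es ⌋ = formula d /ᶠ arguments k es

⌊⌋-correct : ∀ {n} (φ : Pos n) ρ → (ω, ρ ⊨ ⌊ φ ⌋) ⇔ (¬ ¬ ⟦ φ ⟧ᵖ ρ)
⌊⌋-correct (e ≐ᵖ f) ρ rewrite ⟦term⟧ e ρ | ⟦term⟧ f ρ =
  mk⇔ (λ h k → k h) (decidable-stable (⟦ e ⟧ᵉ ρ ≟ ⟦ f ⟧ᵉ ρ))
⌊⌋-correct (e ≤ᵖ f) ρ rewrite ⟦term⟧ e ρ | ⟦term⟧ f ρ =
  mk⇔ (λ h k → k h) (decidable-stable (⟦ e ⟧ᵉ ρ ≤? ⟦ f ⟧ᵉ ρ))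
⌊⌋-correct (φ ∧ᵖ ψ) ρ = mk⇔
  (λ h k → h λ a b → to (⌊⌋-correct φ ρ) a λ p → to (⌊⌋-correct ψ ρ) b λ q → k (p , q))
  (λ h f → h λ { (p , q) → f (from (⌊⌋-correct φ ρ) λ k → k p) (from (⌊⌋-correct ψ ρ) λ k → k q) })
⌊⌋-correct (φ ∨ᵖ ψ) ρ = mk⇔
  (λ h k → to (⌊⌋-correct ψ ρ) (h λ a → to (⌊⌋-correct φ ρ) a (k ∘ inj₁)) (k ∘ inj₂))
  (λ h ¬a → from (⌊⌋-correct ψ ρ) λ ¬q → h λ
    { (inj₁ p) → ¬a (from (⌊⌋-correct φ ρ) λ k → k p)
    ; (inj₂ q) → ¬q q })
⌊⌋-correct (∃ᵖ φ) ρ = mk⇔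
  (λ h k → h λ x a → to (⌊⌋-correct φ (x ∷ ρ)) a λ p → k (x , p))
  (λ h f → h λ { (x , p) → f x (from (⌊⌋-correct φ (x ∷ ρ)) λ k → k p) })
⌊⌋-correct (rel k d es) ρ = mk⇔
  (to (correct d _) ∘ to (⊨-/ᶠ (formula d) (arguments-≈ k es ρ)))
  (from (⊨-/ᶠ (formula d) (arguments-≈ k es ρ)) ∘ from (correct d _))

-- Opaque because the formulas are too large to be computed.
opaque
  pos : ∀ {n} (φ : Pos n) → Def ⟦ φ ⟧ᵖ
  pos φ = def ⌊ φ ⌋ (⌊⌋-correct φ)

-- A finite set L of numbers ≤ M is coded by c = M! and b = ∏ (1 + (y + 1) c)
-- over y ∈ L: the factors are pairwise coprime for distinct y ≤ M, so w ∈ L iff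
-- the factor of w divides b.

factor : ℕ → ℕ → ℕ
factor c y = suc (suc y * c)

-- A common divisor of `d` and `c` divides both 1 + (y + 1) c and (y + 1) c, hence 1.
factor-coprime-∣ : ∀ {d c y} → d ∣ factor c y → Coprime d c
factor-coprime-∣ {d} {c} {y} d∣f {e} (e∣d , e∣c) =
  ∣1⇒≡1 (∣m+n∣m⇒∣n (subst (e ∣_) (+-comm 1 (suc y * c)) (∣-trans e∣d d∣f)) (∣n⇒∣m*n (suc y) e∣c))

factor-∸ : ∀ c {y z} → y < z → factor c z ≡ factor c y + (z ∸ y) * c
factor-∸ c {y} {z} y<z = cong suc (begin
  suc z * c                  ≡⟨ cong (λ k → suc k * c) (m+[n∸m]≡n (<⇒≤ y<z)) ⟨
  (suc y + (z ∸ y)) * c      ≡⟨ *-distribʳ-+ c (suc y) (z ∸ y) ⟩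
  suc y * c + (z ∸ y) * c    ∎)
  where open ≡-Reasoning

∣! : ∀ {M k} → 0 < k → k ≤ M → k ∣ M !
∣! {k = suc k} _ k≤M = ∣-trans (m∣m*n (k !)) (m≤n⇒m!∣n! k≤M)

-- A common divisor divides the difference (z - y) M! and is coprime to M!, so it divides z - y. As
-- 0 < z - y ≤ M, it then divides M! as well, and being coprime to M! it is 1. This is why c is a
-- factorial.
factor-coprime-< : ∀ {M y z} → y < z → z ≤ M → Coprime (factor (M !) y) (factor (M !) z)
factor-coprime-< {M} {y} {z} y<z z≤M {d} (d∣y , d∣z) = cop (∣-refl , d∣c)
  where
  cop : Coprime d (M !)
  cop = factor-coprime-∣ {y = y} d∣y
  d∣[z-y]c : d ∣ (z ∸ y) * M !
  d∣[z-y]c = ∣m+n∣m⇒∣n (subst (d ∣_) (factor-∸ (M !) y<z) d∣z) d∣y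
  d∣z-y : d ∣ z ∸ y
  d∣z-y = coprime-divisor cop (subst (d ∣_) (*-comm (z ∸ y) (M !)) d∣[z-y]c)
  d∣c : d ∣ M !
  d∣c = ∣-trans d∣z-y (∣! (m<n⇒0<n∸m y<z) (≤-trans (m∸n≤m z y) z≤M))

factor-coprime : ∀ {M y z} → y ≤ M → z ≤ M → ¬ y ≡ z → Coprime (factor (M !) y) (factor (M !) z)
factor-coprime {M} {y} {z} y≤M z≤M y≢z with <-cmp y z
... | tri< y<z _ _ = factor-coprime-< y<z z≤M
... | tri≈ _ y≡z _ = contradiction y≡z y≢z
... | tri> _ _ z<y = coprime-sym (factor-coprime-< z<y y≤M)

-- The factor of `w` is coprime to the factor of every other element, so these can be cancelled one
-- by one until `w` itself is met; the empty product is excluded because a factor exceeds 1.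
∈-factors⁻ : ∀ {M w} L → w ≤ M → (∀ {y} → y ∈ᴸ L → y ≤ M) →
  factor (M !) w ∣ product (mapᴸ (factor (M !)) L) → w ∈ᴸ L
∈-factors⁻ {M} {w} [] w≤M L≤M f∣1 =
  contradiction (suc-injective (∣1⇒≡1 f∣1)) (m<n⇒n≢0 (*-mono-≤ (s≤s (z≤n {w})) (1≤n! M)))
∈-factors⁻ {M} {w} (y ∷ L) w≤M L≤M f∣b with w ≟ y
... | yes refl = here refl
... | no w≢y = there (∈-factors⁻ L w≤M (L≤M ∘ there)
      (coprime-divisor (factor-coprime w≤M (L≤M (here refl)) w≢y) f∣b))

∈⇒≤sum : ∀ {x L} → x ∈ᴸ L → x ≤ sum L
∈⇒≤sum {L = y ∷ L} (here refl) = m≤m+n y (sum L)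
∈⇒≤sum {L = y ∷ L} (there x∈L) = ≤-trans (∈⇒≤sum x∈L) (m≤n+m (sum L) y)

-- The environment begins with w, M, b, c. The test includes w ≤ M because coprimality of factors is
-- secured only up to M. The factorial itself is never expressed: every triple M, b, c determines a
-- set, and `derivation-sound` accepts all of them.
elemᵖ : ∀ {n} → Pos (4 + n)
elemᵖ = # 0F ≤ᵖ # 1F ∧ᵖ ∃ᵖ (# 3F ≐ᵖ # 0F ⊗ sucᵉ (sucᵉ (# 1F) ⊗ # 4F))

Elem : ∀ {n} → Vec ℕ (4 + n) → Set
Elem = ⟦ elemᵖ ⟧ᵖ

setCode : ∀ L → ∃ λ M → ∃ λ b → ∃ λ c → ∀ {n} {ρ : Vec ℕ n} {w} →
  (w ∈ᴸ L → Elem (w ∷ M ∷ b ∷ c ∷ ρ)) × (Elem (w ∷ M ∷ b ∷ c ∷ ρ) → w ∈ᴸ L)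
setCode L = M , product (mapᴸ (factor (M !)) L) , M ! ,
  ((λ w∈L → ∈⇒≤sum w∈L , quot (∈⇒∣product (∈-map⁺ (factor (M !)) w∈L))) ,
  (λ { (w≤M , q , eq) → ∈-factors⁻ L w≤M ∈⇒≤sum (divides q eq) }))
  where
  M = sum L
  quot : ∀ {m n} → m ∣ n → ∃ λ q → n ≡ q * m
  quot (divides q eq) = q , eq

-- Definability of inductive closures

data Cl {n} (A : Pos (1 + n)) (D : Pos (3 + n)) (ρ : Vec ℕ n) : ℕ → Set where
  axiom : ∀ {x} → ⟦ A ⟧ᵖ (x ∷ ρ) → Cl A D ρ x
  rule  : ∀ {x y z} → Cl A D ρ y → Cl A D ρ z → ⟦ D ⟧ᵖ (y ∷ z ∷ x ∷ ρ) → Cl A D ρ x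

Closure : ∀ {n} → Pos (1 + n) → Pos (3 + n) → Vec ℕ (1 + n) → Set
Closure A D (x ∷ ρ) = Cl A D ρ x

-- A derivation is represented by a finite set of pairs r ⨾ x, "x is derivable
-- with rank r", in which every element is justified by elements of lower rank.

module _ {n} (A : Pos (1 + n)) (D : Pos (3 + n)) where

  -- The environment is rank, element, M, b, c and the parameters. The strict decrease of ranks
  -- rules out circular justification.
  justifiedᵖ : Pos (5 + n)
  justifiedᵖ = rel 5 (pos A) (# 1F ∷ []) ∨ᵖ
    ∃ᵖ (∃ᵖ (∃ᵖ (∃ᵖ (
      sucᵉ (# 3F) ≤ᵖ # 4F ∧ᵖ rel 9 (pos elemᵖ) (# 3F ⨾ᵉ # 2F ∷ # 6F ∷ # 7F ∷ # 8F ∷ []) ∧ᵖ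
      sucᵉ (# 1F) ≤ᵖ # 4F ∧ᵖ rel 9 (pos elemᵖ) (# 1F ⨾ᵉ # 0F ∷ # 6F ∷ # 7F ∷ # 8F ∷ []) ∧ᵖ
      rel 9 (pos D) (# 2F ∷ # 0F ∷ # 5F ∷ [])))))

  rankedᵖ : Pos (4 + n)
  rankedᵖ = ∃ᵖ (∃ᵖ (# 2F ≐ᵖ # 1F ⨾ᵉ # 0F ∧ᵖ
    rel 6 (pos justifiedᵖ) (# 1F ∷ # 0F ∷ # 3F ∷ # 4F ∷ # 5F ∷ [])))

  derivationᵖ : Pos (1 + n)
  derivationᵖ = ∃ᵖ (∃ᵖ (∃ᵖ (∃ᵖ (
    rel 5 (pos elemᵖ) (# 0F ⨾ᵉ # 4F ∷ # 3F ∷ # 2F ∷ # 1F ∷ []) ∧ᵖ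
    rel 5 (def-∀⇒ (pos elemᵖ) (pos rankedᵖ)) (# 3F ∷ # 2F ∷ # 1F ∷ [])))))

  -- Strong induction on the rank. The double negation is inherited from the hypothesis on the
  -- elements of the set.
  derivation-sound : ∀ {ρ M b c} →
    (∀ w → Elem (w ∷ M ∷ b ∷ c ∷ ρ) → ¬ ¬ ⟦ rankedᵖ ⟧ᵖ (w ∷ M ∷ b ∷ c ∷ ρ)) →
    ∀ r x → Elem (r ⨾ x ∷ M ∷ b ∷ c ∷ ρ) → ¬ ¬ Cl A D ρ x
  derivation-sound {ρ} {M} {b} {c} ranked = <-rec _ λ r ih x rx∈S ¬x →
    ranked (r ⨾ x) rx∈S λ { (s , y , eq , j) → justified ih (⨾-injective eq) j ¬x }
    where
    justified : ∀ {r x s y} →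
      (∀ {r′} → r′ < r → ∀ x → Elem (r′ ⨾ x ∷ M ∷ b ∷ c ∷ ρ) → ¬ ¬ Cl A D ρ x) →
      r ≡ s × x ≡ y → ⟦ justifiedᵖ ⟧ᵖ (s ∷ y ∷ M ∷ b ∷ c ∷ ρ) → ¬ ¬ Cl A D ρ x
    justified ih (refl , refl) (inj₁ a) ¬x = ¬x (axiom a)
    justified ih (refl , refl) (inj₂ (r₁ , y₁ , r₂ , y₂ , r₁<r , e₁ , r₂<r , e₂ , d)) ¬x =
      ih r₁<r y₁ e₁ λ p → ih r₂<r y₂ e₂ λ q → ¬x (rule p q d)

  -- `rankedᵖ` with a list in place of the coded set: lists of subderivations can be merged freely,
  -- and codes are chosen only for the final list.
  data Justified (ρ : Vec ℕ n) (L : List ℕ) : ℕ → Set where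
    axiomᴶ : ∀ {r x} → ⟦ A ⟧ᵖ (x ∷ ρ) → Justified ρ L (r ⨾ x)
    ruleᴶ  : ∀ {r x r₁ y₁ r₂ y₂} → r₁ < r → r₁ ⨾ y₁ ∈ᴸ L → r₂ < r → r₂ ⨾ y₂ ∈ᴸ L →
      ⟦ D ⟧ᵖ (y₁ ∷ y₂ ∷ x ∷ ρ) → Justified ρ L (r ⨾ x)

  weaken-Justified : ∀ {ρ L L′ w} → L ⊆ᴸ L′ → Justified ρ L w → Justified ρ L′ w
  weaken-Justified L⊆L′ (axiomᴶ a) = axiomᴶ a
  weaken-Justified L⊆L′ (ruleᴶ r₁<r e₁ r₂<r e₂ d) = ruleᴶ r₁<r (L⊆L′ e₁) r₂<r (L⊆L′ e₂) d

  derivation : ∀ {ρ x} → Cl A D ρ x → ∃ λ r → ∃ λ L →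
    r ⨾ x ∈ᴸ L × (∀ {w} → w ∈ᴸ L → Justified ρ L w)
  derivation {x = x} (axiom a) = 0 , 0 ⨾ x ∷ [] , here refl , λ { (here refl) → axiomᴶ a }
  derivation {ρ} {x} (rule {y = y} {z} p q d)
    with derivation p | derivation q
  ... | r₁ , L₁ , e₁ , j₁ | r₂ , L₂ , e₂ , j₂ = r , L , here refl , j
    where
    r = suc (r₁ + r₂)
    L = r ⨾ x ∷ L₁ ++ᴸ L₂
    L₁⊆L : L₁ ⊆ᴸ L
    L₁⊆L = there ∘ xs⊆xs++ys L₁ L₂
    L₂⊆L : L₂ ⊆ᴸ L
    L₂⊆L = there ∘ xs⊆ys++xs L₂ L₁
    j : ∀ {w} → w ∈ᴸ L → Justified ρ L w
    j (here refl) = ruleᴶ (s≤s (m≤m+n r₁ r₂)) (L₁⊆L e₁) (s≤s (m≤n+m r₂ r₁)) (L₂⊆L e₂) d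
    j (there w∈) with ∈-++⁻ L₁ w∈
    ... | inj₁ w∈L₁ = weaken-Justified L₁⊆L (j₁ w∈L₁)
    ... | inj₂ w∈L₂ = weaken-Justified L₂⊆L (j₂ w∈L₂)

  derivation-complete : ∀ {ρ x} → Cl A D ρ x → ⟦ derivationᵖ ⟧ᵖ (x ∷ ρ)
  derivation-complete {ρ} p with derivation p
  ... | r , L , e , j with setCode L
  ... | M , b , c , S = M , b , c , r , proj₁ (S {ρ = ρ}) e , λ w w∈ ¬j → ¬j (ranked (j (proj₂ (S {ρ = ρ}) w∈)))
    where
    ranked : ∀ {w} → Justified ρ L w → ⟦ rankedᵖ ⟧ᵖ (w ∷ M ∷ b ∷ c ∷ ρ)
    ranked (axiomᴶ a) = _ , _ , refl , inj₁ a
    ranked (ruleᴶ r₁<r e₁ r₂<r e₂ d) =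
      _ , _ , refl , inj₂ (_ , _ , _ , _ , r₁<r , proj₁ (S {ρ = ρ}) e₁ , r₂<r , proj₁ (S {ρ = ρ}) e₂ , d)

  opaque
    closure : Def (Closure A D)
    closure = def-≈ {P = ⟦ derivationᵖ ⟧ᵖ}
      (λ { {x ∷ ρ} (M , b , c , r , e , ranked) → derivation-sound ranked r x e })
      (λ { {x ∷ ρ} → derivation-complete })
      (pos derivationᵖ)

-- The Gödel sentence

numeralᴬ : Pos 1
numeralᴬ = # 0F ≐ᵖ lit 0 ⨾ᵉ lit 1 ⨾ᵉ lit 0

numeralᴰ : Pos 3
numeralᴰ = ∃ᵖ (∃ᵖ (# 2F ≐ᵖ # 1F ⨾ᵉ # 0F ∧ᵖ # 4F ≐ᵖ sucᵉ (# 1F) ⨾ᵉ lit 2 ⨾ᵉ # 0F))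

NumeralCode : Vec ℕ 2 → Set
NumeralCode (m ∷ c ∷ []) = c ≡ codeᵗ (numeral {1} m)

opaque
  numeralCode : Def NumeralCode
  numeralCode = def-⇔ (λ { {m ∷ c ∷ []} → sound }) (λ { {m ∷ c ∷ []} refl → complete m })
    (pos (rel 2 (closure numeralᴬ numeralᴰ) (# 0F ⨾ᵉ # 1F ∷ [])))
    where
    -- An equation for an arbitrary member `x` replaces an index of the form `m ⨾ c`, on which
    -- matching the `refl` of an axiom or rule would get stuck. Later soundness lemmas about pairs
    -- have this form for the same reason.
    sound′ : ∀ {x} → Cl numeralᴬ numeralᴰ [] x → ∃ λ m → x ≡ m ⨾ codeᵗ (numeral {1} m)
    sound′ (axiom refl) = 0 , refl
    sound′ (rule p _ (m , c , refl , refl)) with sound′ p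
    ... | m′ , eq with ⨾-injective eq
    ... | refl , refl = suc m , refl
    sound : ∀ {m c} → Cl numeralᴬ numeralᴰ [] (m ⨾ c) → c ≡ codeᵗ (numeral {1} m)
    sound p with sound′ p
    ... | m′ , eq with ⨾-injective eq
    ... | refl , refl = refl
    complete : ∀ m → Cl numeralᴬ numeralᴰ [] (m ⨾ codeᵗ (numeral {1} m))
    complete zero    = axiom refl
    -- The rule has one genuine premise, supplied twice to fill both places.
    complete (suc m) = rule (complete m) (complete m) (m , _ , refl , refl)

opaque
  ⊨-def : ∀ {n} (φ : Formula n) → Def (λ ρ → ω, ρ ⊨ φ)
  ⊨-def φ = def φ λ ρ → mk⇔ (λ h k → k h) (⊨-stable φ)

-- Instead of substituting the numeral of m = code φ for x in φ, one takes
-- ∀ x (x ≐ m ⇒ φ), whose code is a polynomial in m and the code of the numeral.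
diagonal : (φ : Formula 1) → Σ Sentence λ γ → True γ ⇔ ω, code γ ∷ [] ⊨ φ
diagonal φ = γ , mk⇔
  (λ h → ⊨-stable φ λ ¬φ →
    to (correct (pos selfᵖ) (m ∷ [])) (h m (sym (⟦numeral⟧ m (m ∷ [])))) λ { (c , refl , a) → ¬φ a })
  (λ a x eq → subst (λ x → ω, x ∷ [] ⊨ ψ) (sym (trans eq (⟦numeral⟧ m (x ∷ []))))
    (from (correct (pos selfᵖ) (m ∷ [])) λ k → k (_ , refl , a)))
  where
  -- At x this applies `φ` to the code of `∀ᶠ (var 0F ≐ numeral x ⇒ χ)`, where x is the code of `χ`:
  -- 9, 8 and 5 are the tags of `∀ᶠ`, `_⇒_` and `_≐_`, and `0 ⨾ 0` codes `var 0F`. For x = `code ψ`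
  -- that sentence is `γ`.
  selfᵖ : Pos 1
  selfᵖ = ∃ᵖ (rel 2 numeralCode (# 1F ∷ # 0F ∷ []) ∧ᵖ
    rel 2 (⊨-def φ) (lit 9 ⨾ᵉ lit 8 ⨾ᵉ (lit 5 ⨾ᵉ (lit 0 ⨾ᵉ lit 0) ⨾ᵉ # 0F) ⨾ᵉ # 1F ∷ []))
  ψ = formula (pos selfᵖ)
  m = code ψ
  γ = ∀ᶠ (var 0F ≐ numeral m ⇒ ψ)

-- `φ` yields provability only up to double negation, which suffices because every use of it ends in
-- a contradiction.
incomplete : ∀ {ℓ} (T : Theory ℓ) → Definable (Pr T) → Sound T → Incomplete T
incomplete T (φ , φ⇔Pr) sound with diagonal (¬ᶠ φ)
... | γ , γ⇔ = γ , ⊬γ , λ ⊢¬γ → ⊢-sound sound ⊢¬γ [] (from γ⇔ λ a →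
      to (φ⇔Pr (code γ)) a λ p → ⊬γ (provable p))
  where
  provable : Pr T (code γ) → T ⊢ γ
  provable (σ , eq , d) = subst (T ⊢_) (code-injective σ γ (trans (code-⌜⌝ σ) eq)) d
  ⊬γ : ¬ (T ⊢ γ)
  ⊬γ d = to γ⇔ (⊢-sound sound d []) (from (φ⇔Pr (code γ)) λ k → k (γ , sym (code-⌜⌝ γ) , d))

-- Recursive functions

mutual
  -- For `μ`, the smaller of two distinct results would give `f` both the value zero and a successor
  -- value.
  ⇓-deterministic : ∀ {n} {f : Rec n} {xs y z} → f ∙ xs ⇓ y → f ∙ xs ⇓ z → y ≡ z
  ⇓-deterministic ⇓zero ⇓zero = refl
  ⇓-deterministic ⇓suc ⇓suc = refl
  ⇓-deterministic (⇓proj i) (⇓proj i) = refl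
  ⇓-deterministic (⇓comp ps p) (⇓comp qs q) with ⇓⋆-deterministic ps qs
  ... | refl = ⇓-deterministic p q
  ⇓-deterministic (⇓prec-0 p) (⇓prec-0 q) = ⇓-deterministic p q
  ⇓-deterministic (⇓prec-s p p′) (⇓prec-s q q′) with ⇓-deterministic p q
  ... | refl = ⇓-deterministic p′ q′
  ⇓-deterministic (⇓μ {y = y} p ps) (⇓μ {y = z} q qs) with <-cmp y z
  ... | tri≈ _ y≡z _ = y≡z
  ... | tri< y<z _ _ = contradiction (⇓-deterministic p (proj₂ (qs y y<z))) λ ()
  ... | tri> _ _ z<y = contradiction (⇓-deterministic (proj₂ (ps z z<y)) q) λ ()

  ⇓⋆-deterministic : ∀ {m n} {gs : Vec (Rec n) m} {xs ys zs} →
    Pointwise (λ g y → g ∙ xs ⇓ y) gs ys → Pointwise (λ g y → g ∙ xs ⇓ y) gs zs → ys ≡ zs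
  ⇓⋆-deterministic [] [] = refl
  ⇓⋆-deterministic (p ∷ ps) (q ∷ qs) =
    cong₂ _∷_ (⇓-deterministic p q) (⇓⋆-deterministic ps qs)

-- Packing the arguments into one number lets the graph of a function of any arity be a `Pos 2`,
-- with the value first and the argument list second.
list : ∀ {n} → Vec ℕ n → ℕ
list []       = 0
list (x ∷ xs) = x ⨾ list xs

projᵖ : ∀ {n} → Fin n → Pos 2
projᵖ zero    = ∃ᵖ (# 2F ≐ᵖ # 1F ⨾ᵉ # 0F)
projᵖ (suc i) = ∃ᵖ (∃ᵖ (# 3F ≐ᵖ # 1F ⨾ᵉ # 0F ∧ᵖ rel 4 (pos (projᵖ i)) (# 2F ∷ # 0F ∷ [])))

precᴬ : Pos 2 → Pos 2
precᴬ f = ∃ᵖ (# 1F ≐ᵖ lit 0 ⨾ᵉ # 0F ∧ᵖ rel 3 (pos f) (# 0F ∷ # 2F ∷ []))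

precᴰ : Pos 2 → Pos 4
precᴰ g = ∃ᵖ (∃ᵖ (∃ᵖ (# 3F ≐ᵖ # 2F ⨾ᵉ # 1F ∧ᵖ # 5F ≐ᵖ sucᵉ (# 2F) ⨾ᵉ # 0F ∧ᵖ
  rel 7 (pos g) (# 0F ∷ # 2F ⨾ᵉ # 1F ⨾ᵉ # 6F ∷ []))))

-- The bounded quantifier in `μ` turns into a closure: y is reached from 0 by successor steps, each
-- certifying a nonzero value of `f` at the number it leaves.
searchᴬ : Pos 2
searchᴬ = # 0F ≐ᵖ lit 0

searchᴰ : Pos 2 → Pos 4
searchᴰ f = # 2F ≐ᵖ sucᵉ (# 0F) ∧ᵖ ∃ᵖ (rel 5 (pos f) (sucᵉ (# 0F) ∷ # 1F ⨾ᵉ # 4F ∷ []))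

mutual
  evalᵖ : ∀ {n} → Rec n → Pos 2
  evalᵖ zeroʳ       = # 0F ≐ᵖ lit 0
  evalᵖ sucʳ        = ∃ᵖ (# 2F ≐ᵖ # 0F ⨾ᵉ lit 0 ∧ᵖ # 1F ≐ᵖ sucᵉ (# 0F))
  evalᵖ (proj i)    = projᵖ i
  evalᵖ (comp f gs) = ∃ᵖ (
    rel 3 (pos (eval⋆ᵖ gs)) (# 0F ∷ # 2F ∷ []) ∧ᵖ rel 3 (pos (evalᵖ f)) (# 1F ∷ # 0F ∷ []))
  evalᵖ (prec f g)  = ∃ᵖ (∃ᵖ (# 3F ≐ᵖ # 1F ⨾ᵉ # 0F ∧ᵖ
    rel 4 (closure (precᴬ (evalᵖ f)) (precᴰ (evalᵖ g))) (# 1F ⨾ᵉ # 2F ∷ # 0F ∷ [])))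
  evalᵖ (μ f)       = rel 2 (pos (evalᵖ f)) (lit 0 ∷ # 0F ⨾ᵉ # 1F ∷ []) ∧ᵖ
    rel 2 (closure searchᴬ (searchᴰ (evalᵖ f))) (# 0F ∷ # 1F ∷ [])

  eval⋆ᵖ : ∀ {m n} → Vec (Rec n) m → Pos 2
  eval⋆ᵖ []       = # 0F ≐ᵖ lit 0
  eval⋆ᵖ (g ∷ gs) = ∃ᵖ (∃ᵖ (# 2F ≐ᵖ # 1F ⨾ᵉ # 0F ∧ᵖ
    rel 4 (pos (evalᵖ g)) (# 1F ∷ # 3F ∷ []) ∧ᵖ rel 4 (pos (eval⋆ᵖ gs)) (# 0F ∷ # 3F ∷ [])))

proj-sound : ∀ {n} (i : Fin n) xs {y} → ⟦ projᵖ i ⟧ᵖ (y ∷ list xs ∷ []) → lookup xs i ≡ y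
proj-sound zero    (x ∷ xs) (_ , eq) = ⨾-injectiveˡ eq
proj-sound (suc i) (x ∷ xs) (_ , c , eq , p) with ⨾-injective eq
... | refl , refl = proj-sound i xs p

proj-complete : ∀ {n} (i : Fin n) xs → ⟦ projᵖ i ⟧ᵖ (lookup xs i ∷ list xs ∷ [])
proj-complete zero    (x ∷ xs) = list xs , refl
proj-complete (suc i) (x ∷ xs) = x , list xs , refl , proj-complete i xs

mutual
  eval-sound : ∀ {n} (f : Rec n) xs {y} → ⟦ evalᵖ f ⟧ᵖ (y ∷ list xs ∷ []) → f ∙ xs ⇓ y
  eval-sound zeroʳ xs refl = ⇓zero
  eval-sound sucʳ (x ∷ []) (_ , eq , refl) with ⨾-injective eq
  ... | refl , _ = ⇓suc
  eval-sound (proj i) xs p = subst (proj i ∙ xs ⇓_) (proj-sound i xs p) (⇓proj i)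
  eval-sound (comp f gs) xs (_ , p , q) with eval⋆-sound gs xs p
  ... | ys , refl , ps = ⇓comp ps (eval-sound f ys q)
  eval-sound (prec f g) (k ∷ xs) (_ , _ , eq , p) with ⨾-injective eq
  ... | refl , refl = prec-sound f g xs p refl
  eval-sound (μ f) xs (p , q) = ⇓μ (eval-sound f (_ ∷ xs) p) (search-sound f xs q)

  eval⋆-sound : ∀ {m n} (gs : Vec (Rec n) m) xs {d} → ⟦ eval⋆ᵖ gs ⟧ᵖ (d ∷ list xs ∷ []) →
    Σ (Vec ℕ m) λ ys → d ≡ list ys × Pointwise (λ g y → g ∙ xs ⇓ y) gs ys
  eval⋆-sound []       xs refl = [] , refl , []
  eval⋆-sound (g ∷ gs) xs (y , _ , refl , p , q) with eval⋆-sound gs xs q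
  ... | ys , refl , ps = y ∷ ys , refl , eval-sound g xs p ∷ ps

  prec-sound : ∀ {n} (f : Rec n) g xs {k y w} →
    Cl (precᴬ (evalᵖ f)) (precᴰ (evalᵖ g)) (list xs ∷ []) w → w ≡ k ⨾ y → prec f g ∙ k ∷ xs ⇓ y
  prec-sound f g xs (axiom (_ , refl , p)) eq with ⨾-injective eq
  ... | refl , refl = ⇓prec-0 (eval-sound f xs p)
  prec-sound f g xs (rule p _ (k , y , _ , refl , refl , q)) eq with ⨾-injective eq
  ... | refl , refl = ⇓prec-s (prec-sound f g xs p refl) (eval-sound g (k ∷ y ∷ xs) q)

  search-sound : ∀ {n} (f : Rec (suc n)) xs {y} →
    Cl searchᴬ (searchᴰ (evalᵖ f)) (list xs ∷ []) y → ∀ z → z < y → ∃ λ w → f ∙ z ∷ xs ⇓ suc w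
  search-sound f xs (axiom refl) z ()
  search-sound f xs (rule {y = y} p _ (refl , w , q)) z z<1+y with m≤n⇒m<n∨m≡n (s≤s⁻¹ z<1+y)
  ... | inj₁ z<y  = search-sound f xs p z z<y
  ... | inj₂ refl = w , eval-sound f (y ∷ xs) q

mutual
  eval-complete : ∀ {n} {f : Rec n} {xs y} → f ∙ xs ⇓ y → ⟦ evalᵖ f ⟧ᵖ (y ∷ list xs ∷ [])
  eval-complete ⇓zero = refl
  eval-complete ⇓suc = _ , refl , refl
  eval-complete {xs = xs} (⇓proj i) = proj-complete i xs
  eval-complete (⇓comp ps p) = _ , eval⋆-complete ps , eval-complete p
  eval-complete (⇓prec-0 p) = _ , _ , refl , axiom (_ , refl , eval-complete p)
  eval-complete (⇓prec-s p q) with eval-complete p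
  ... | _ , _ , eq , r with ⨾-injective eq
  ... | refl , refl = _ , _ , refl , rule r r (_ , _ , _ , refl , refl , eval-complete q)
  eval-complete (⇓μ p ps) =
    eval-complete p , search-complete _ λ z z<y → proj₁ (ps z z<y) , eval-complete (proj₂ (ps z z<y))

  eval⋆-complete : ∀ {m n} {gs : Vec (Rec n) m} {xs ys} →
    Pointwise (λ g y → g ∙ xs ⇓ y) gs ys → ⟦ eval⋆ᵖ gs ⟧ᵖ (list ys ∷ list xs ∷ [])
  eval⋆-complete []       = refl
  eval⋆-complete (p ∷ ps) = _ , _ , refl , eval-complete p , eval⋆-complete ps

  search-complete : ∀ {f : Pos 2} {c} y → (∀ z → z < y → ∃ λ w → ⟦ f ⟧ᵖ (suc w ∷ z ⨾ c ∷ [])) →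
    Cl searchᴬ (searchᴰ f) (c ∷ []) y
  search-complete zero    h = axiom refl
  search-complete {f} (suc y) h = rule p p (refl , h y ≤-refl)
    where p = search-complete {f} y λ z z<y → h z (m<n⇒m<1+n z<y)

-- `P` may live at any level whereas `Def` speaks of predicates in `Set`; having value 1 under `f`
-- is the small substitute for membership.
Recursive⇒Def : ∀ {ℓ} (P : ℕ → Set ℓ) → Recursive P →
  Σ (Rec 1) λ f → Def (λ ρ → f ∙ ρ ⇓ 1) × (∀ n → f ∙ n ∷ [] ⇓ 1 ⇔ n ∈ P)
Recursive⇒Def P (f , decide) =
  f , def-⇔ (λ { {n ∷ []} → eval-sound f (n ∷ []) }) (λ { {n ∷ []} → eval-complete })
      (pos (rel 1 (pos (evalᵖ f)) (lit 1 ∷ # 0F ⨾ᵉ lit 0 ∷ []))) ,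
  λ n → mk⇔ (sound n) (complete n)
  where
  sound : ∀ n → f ∙ n ∷ [] ⇓ 1 → n ∈ P
  sound n p with decide n
  ... | inj₁ (n∈P , _) = n∈P
  ... | inj₂ (_ , q)   = contradiction (⇓-deterministic p q) λ ()
  complete : ∀ n → n ∈ P → f ∙ n ∷ [] ⇓ 1
  complete n n∈P with decide n
  ... | inj₁ (_ , p)   = p
  ... | inj₂ (n∉P , _) = contradiction n∈P n∉P

-- Substitution

-- The closure consists of pairs of the code of a term and the code of its image; `V` is the graph
-- of the substitution on variables.
termᴬ : ∀ {p} {V : Vec ℕ (2 + p) → Set} → Def V → Pos (1 + p)
termᴬ V = ∃ᵖ (∃ᵖ (# 2F ≐ᵖ (lit 0 ⨾ᵉ # 1F) ⨾ᵉ # 0F ∧ᵖ rel 3 V (# 1F ∷ # 0F ∷ [])))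
  ∨ᵖ # 0F ≐ᵖ (lit 1 ⨾ᵉ lit 0) ⨾ᵉ lit 1 ⨾ᵉ lit 0

termᴰ : ∀ {p} → Pos (3 + p)
termᴰ = ∃ᵖ (∃ᵖ (∃ᵖ (∃ᵖ (# 4F ≐ᵖ # 3F ⨾ᵉ # 2F ∧ᵖ # 5F ≐ᵖ # 1F ⨾ᵉ # 0F ∧ᵖ
  (# 6F ≐ᵖ (lit 2 ⨾ᵉ # 3F) ⨾ᵉ lit 2 ⨾ᵉ # 2F ∨ᵖ
   # 6F ≐ᵖ (lit 3 ⨾ᵉ # 3F ⨾ᵉ # 1F) ⨾ᵉ lit 3 ⨾ᵉ # 2F ⨾ᵉ # 0F ∨ᵖ
   # 6F ≐ᵖ (lit 4 ⨾ᵉ # 3F ⨾ᵉ # 1F) ⨾ᵉ lit 4 ⨾ᵉ # 2F ⨾ᵉ # 0F)))))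

VarImage : ∀ {T : ℕ → Set} {m n} → Lift T Term → Sub T m n → ℕ → ℕ → Set
VarImage {m = m} l σ x u = Σ (Fin m) λ i → x ≡ toℕ i × u ≡ codeᵗ (Lift.lift l (lookup σ i))

-- Since `V` must fail at every x ≥ m, the closure built on it generates only terms in m variables.
Represents : ∀ {T : ℕ → Set} {p m n} → (Vec ℕ (2 + p) → Set) → Vec ℕ p → Lift T Term → Sub T m n → Set
Represents V ρ l σ = ∀ {x u} → V (x ∷ u ∷ ρ) ⇔ VarImage l σ x u

term-sound : ∀ {T : ℕ → Set} {p m n} {V : Vec ℕ (2 + p) → Set} (dV : Def V) {ρ}
  (l : Lift T Term) (σ : Sub T m n) → Represents V ρ l σ →
  ∀ {w} → Cl (termᴬ dV) termᴰ ρ w →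
  Σ (Term m) λ t → w ≡ codeᵗ t ⨾ codeᵗ (TermApp._/ᵗ_ l t σ)
term-sound dV l σ h (axiom (inj₁ (_ , _ , refl , v))) with to h v
... | i , refl , refl = var i , refl
term-sound dV l σ h (axiom (inj₂ refl)) = 0ᵗ , refl
term-sound dV l σ h (rule p q (_ , _ , _ , _ , refl , refl , r))
  with term-sound dV l σ h p | term-sound dV l σ h q
... | t , eq | u , eq′ with ⨾-injective eq | ⨾-injective eq′ | r
... | refl , refl | refl , refl | inj₁ refl        = sᵗ t , refl
... | refl , refl | refl , refl | inj₂ (inj₁ refl) = t +ᵗ u , refl
... | refl , refl | refl , refl | inj₂ (inj₂ refl) = t *ᵗ u , refl

term-complete : ∀ {T : ℕ → Set} {p m n} {V : Vec ℕ (2 + p) → Set} (dV : Def V) {ρ}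
  (l : Lift T Term) (σ : Sub T m n) → Represents V ρ l σ →
  ∀ t → Cl (termᴬ dV) termᴰ ρ (codeᵗ t ⨾ codeᵗ (TermApp._/ᵗ_ l t σ))
term-complete dV l σ h (var i)  = axiom (inj₁ (_ , _ , refl , from h (i , refl , refl)))
term-complete dV l σ h 0ᵗ       = axiom (inj₂ refl)
term-complete dV l σ h (sᵗ t)   = rule p p (_ , _ , _ , _ , refl , refl , inj₁ refl)
  where p = term-complete dV l σ h t
term-complete dV l σ h (t +ᵗ u) =
  rule (term-complete dV l σ h t) (term-complete dV l σ h u)
    (_ , _ , _ , _ , refl , refl , inj₂ (inj₁ refl))
term-complete dV l σ h (t *ᵗ u) =
  rule (term-complete dV l σ h t) (term-complete dV l σ h u)
    (_ , _ , _ , _ , refl , refl , inj₂ (inj₂ refl))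

weakenVarᵖ : ∀ {p} → Pos (3 + p)
weakenVarᵖ = sucᵉ (# 0F) ≤ᵖ # 2F ∧ᵖ # 1F ≐ᵖ lit 0 ⨾ᵉ sucᵉ (# 0F)

weakenVar-represents : ∀ {p} n {ρ : Vec ℕ p} →
  Represents ⟦ weakenVarᵖ ⟧ᵖ (n ∷ ρ) T.varLift (VarSubst.wk {n})
weakenVar-represents n = mk⇔
  (λ { (x<n , refl) → fromℕ< x<n , sym (toℕ-fromℕ< x<n) ,
    sym (trans (cong (λ j → 0 ⨾ toℕ j) (VarLemmas.lookup-wk (fromℕ< x<n)))
               (cong (λ x → 0 ⨾ suc x) (toℕ-fromℕ< x<n))) })
  (λ { (i , refl , refl) → toℕ<n i , cong (λ j → 0 ⨾ toℕ j) (VarLemmas.lookup-wk i) })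

WeakenImage : ∀ {p} → Vec ℕ (3 + p) → Set
WeakenImage (c ∷ c′ ∷ n ∷ ρ) = Σ (Term n) λ t → c ≡ codeᵗ t × c′ ≡ codeᵗ (T.weaken t)

opaque
  weakenImage : ∀ {p} → Def (WeakenImage {p})
  weakenImage = def-⇔
    (λ { {c ∷ c′ ∷ n ∷ ρ} p → sound p })
    (λ { {c ∷ c′ ∷ n ∷ ρ} (t , refl , refl) →
      term-complete (pos weakenVarᵖ) T.varLift VarSubst.wk (weakenVar-represents n {ρ}) t })
    (pos (rel 2 (closure (termᴬ (pos weakenVarᵖ)) termᴰ) (# 0F ⨾ᵉ # 1F ∷ [])))
    where
    sound : ∀ {c c′ n p} {ρ : Vec ℕ p} → Cl (termᴬ (pos weakenVarᵖ)) termᴰ (n ∷ ρ) (c ⨾ c′) →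
      WeakenImage (c ∷ c′ ∷ n ∷ ρ)
    sound {n = n} {ρ = ρ} p
      with term-sound (pos weakenVarᵖ) T.varLift VarSubst.wk (weakenVar-represents n {ρ}) p
    ... | t , eq = t , ⨾-injective eq

-- In the closures below the first parameter is the number n of variables of the
-- target of a substitution σ, whose action on variables is represented by V; the
-- first component of an element is the number k of binders passed, so that σ ↑⋆ k
-- acts on the remaining components.

liftᴬ : ∀ {p} {V : Vec ℕ (3 + p) → Set} → Def V → Pos (2 + p)
liftᴬ V = ∃ᵖ (∃ᵖ (# 2F ≐ᵖ lit 0 ⨾ᵉ # 1F ⨾ᵉ # 0F ∧ᵖ rel 3 V (# 1F ∷ # 0F ∷ [])))
  ∨ᵖ ∃ᵖ (# 1F ≐ᵖ sucᵉ (# 0F) ⨾ᵉ lit 0 ⨾ᵉ lit 0 ⨾ᵉ lit 0)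

liftᴰ : ∀ {p} → Pos (4 + p)
liftᴰ = ∃ᵖ (∃ᵖ (∃ᵖ (∃ᵖ (
  # 4F ≐ᵖ # 3F ⨾ᵉ # 2F ⨾ᵉ # 1F ∧ᵖ # 6F ≐ᵖ sucᵉ (# 3F) ⨾ᵉ sucᵉ (# 2F) ⨾ᵉ # 0F ∧ᵖ
  -- The term being weakened has k + n variables, the target size of `σ ↑⋆ k`.
  rel 8 weakenImage (# 1F ∷ # 0F ∷ # 3F ⊕ # 7F ∷ [])))))

lookup-↑ : ∀ {m n} (σ : Sub Term m n) i → lookup (σ ↑) (suc i) ≡ T.weaken (lookup σ i)
lookup-↑ σ i = lookup-map i T.weaken σ

lift-sound : ∀ {p m n} {V : Vec ℕ (3 + p) → Set} (dV : Def V) {ρ} (σ : Sub Term m n) →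
  Represents V (n ∷ ρ) T.termLift σ → ∀ {w} → Cl (liftᴬ dV) liftᴰ (n ∷ ρ) w →
  ∃ λ k → Σ (Fin (k + m)) λ i → w ≡ k ⨾ toℕ i ⨾ codeᵗ (lookup (σ T.↑⋆ k) i)
lift-sound dV σ h (axiom (inj₁ (_ , _ , refl , v))) with to h v
... | i , refl , refl = 0 , i , refl
lift-sound dV σ h (axiom (inj₂ (k , refl))) = suc k , zero , refl
lift-sound dV σ h (rule p _ (_ , _ , _ , _ , refl , refl , t , eq , refl)) with lift-sound dV σ h p
... | k , i , eq′ with ⨾-injective eq′
... | refl , eq″ with ⨾-injective eq″
... | refl , refl = suc k , suc i , cong (λ u → suc k ⨾ suc (toℕ i) ⨾ codeᵗ u)
      (sym (trans (lookup-↑ (σ T.↑⋆ k) i) (cong T.weaken (codeᵗ-injective (lookup (σ T.↑⋆ k) i) t eq))))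

lift-complete : ∀ {p m n} {V : Vec ℕ (3 + p) → Set} (dV : Def V) {ρ} (σ : Sub Term m n) →
  Represents V (n ∷ ρ) T.termLift σ → ∀ k i →
  Cl (liftᴬ dV) liftᴰ (n ∷ ρ) (k ⨾ toℕ i ⨾ codeᵗ (lookup (σ T.↑⋆ k) i))
lift-complete dV σ h zero    i       = axiom (inj₁ (_ , _ , refl , from h (i , refl , refl)))
lift-complete dV σ h (suc k) zero    = axiom (inj₂ (k , refl))
lift-complete dV σ h (suc k) (suc i) = rule p p (_ , _ , _ , _ , refl , refl ,
  lookup (σ T.↑⋆ k) i , refl , cong codeᵗ (lookup-↑ (σ T.↑⋆ k) i))
  where p = lift-complete dV σ h k i

-- The order x, u, k makes the binder depth k a parameter, so that this relation can itself serve as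
-- the `V` of `termᴬ`.
LiftImage : ∀ {p} {V : Vec ℕ (3 + p) → Set} → Def V → Vec ℕ (4 + p) → Set
LiftImage dV (x ∷ u ∷ k ∷ ρ) = Cl (liftᴬ dV) liftᴰ ρ (k ⨾ x ⨾ u)

opaque
  liftImage : ∀ {p} {V : Vec ℕ (3 + p) → Set} (dV : Def V) → Def (LiftImage dV)
  liftImage dV = def-⇔ (λ { {_ ∷ _ ∷ _ ∷ _} p → p }) (λ { {_ ∷ _ ∷ _ ∷ _} p → p })
    (pos (rel 3 (closure (liftᴬ dV) liftᴰ) (# 2F ⨾ᵉ # 0F ⨾ᵉ # 1F ∷ [])))

liftImage-represents : ∀ {p m n} {V : Vec ℕ (3 + p) → Set} (dV : Def V) {ρ} (σ : Sub Term m n) →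
  Represents V (n ∷ ρ) T.termLift σ →
  ∀ k → Represents (LiftImage dV) (k ∷ n ∷ ρ) T.termLift (σ T.↑⋆ k)
liftImage-represents {n = n} dV {ρ} σ h k =
  mk⇔ sound (λ { (i , refl , refl) → lift-complete dV σ h k i })
  where
  sound : ∀ {x u} → LiftImage dV (x ∷ u ∷ k ∷ n ∷ ρ) → VarImage T.termLift (σ T.↑⋆ k) x u
  sound p with lift-sound dV σ h p
  ... | _ , i , eq with ⨾-injective eq
  ... | refl , eq′ = i , ⨾-injective eq′

TermImage : ∀ {p} {V : Vec ℕ (3 + p) → Set} → Def V → Vec ℕ (4 + p) → Set
TermImage dV (c ∷ c′ ∷ ρ) = Cl (termᴬ (liftImage dV)) termᴰ ρ (c ⨾ c′)

opaque
  termImage : ∀ {p} {V : Vec ℕ (3 + p) → Set} (dV : Def V) → Def (TermImage dV)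
  termImage dV = def-⇔ (λ { {_ ∷ _ ∷ _} p → p }) (λ { {_ ∷ _ ∷ _} p → p })
    (pos (rel 2 (closure (termᴬ (liftImage dV)) termᴰ) (# 0F ⨾ᵉ # 1F ∷ [])))

formᴬ : ∀ {p} {V : Vec ℕ (3 + p) → Set} → Def V → Pos (2 + p)
formᴬ dV = ∃ᵖ (∃ᵖ (∃ᵖ (∃ᵖ (∃ᵖ (
    rel 6 (termImage dV) (# 3F ∷ # 2F ∷ # 4F ∷ []) ∧ᵖ
    rel 6 (termImage dV) (# 1F ∷ # 0F ∷ # 4F ∷ []) ∧ᵖ
    (# 5F ≐ᵖ # 4F ⨾ᵉ (lit 5 ⨾ᵉ # 3F ⨾ᵉ # 1F) ⨾ᵉ lit 5 ⨾ᵉ # 2F ⨾ᵉ # 0F ∨ᵖ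
     # 5F ≐ᵖ # 4F ⨾ᵉ (lit 6 ⨾ᵉ # 3F ⨾ᵉ # 1F) ⨾ᵉ lit 6 ⨾ᵉ # 2F ⨾ᵉ # 0F))))))
  ∨ᵖ ∃ᵖ (# 1F ≐ᵖ # 0F ⨾ᵉ (lit 7 ⨾ᵉ lit 0) ⨾ᵉ lit 7 ⨾ᵉ lit 0)

formᴰ : ∀ {p} → Pos (4 + p)
formᴰ = ∃ᵖ (∃ᵖ (∃ᵖ (∃ᵖ (∃ᵖ (
    # 5F ≐ᵖ # 4F ⨾ᵉ # 3F ⨾ᵉ # 2F ∧ᵖ # 6F ≐ᵖ # 4F ⨾ᵉ # 1F ⨾ᵉ # 0F ∧ᵖ
    # 7F ≐ᵖ # 4F ⨾ᵉ (lit 8 ⨾ᵉ # 3F ⨾ᵉ # 1F) ⨾ᵉ lit 8 ⨾ᵉ # 2F ⨾ᵉ # 0F)))))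
  ∨ᵖ ∃ᵖ (∃ᵖ (∃ᵖ (
    # 3F ≐ᵖ sucᵉ (# 2F) ⨾ᵉ # 1F ⨾ᵉ # 0F ∧ᵖ
    # 5F ≐ᵖ # 2F ⨾ᵉ (lit 9 ⨾ᵉ # 1F) ⨾ᵉ lit 9 ⨾ᵉ # 0F)))

form-sound : ∀ {p m n} {V : Vec ℕ (3 + p) → Set} (dV : Def V) {ρ} (σ : Sub Term m n) →
  Represents V (n ∷ ρ) T.termLift σ → ∀ {w} → Cl (formᴬ dV) formᴰ (n ∷ ρ) w →
  ∃ λ k → Σ (Formula (k + m)) λ φ → w ≡ k ⨾ code φ ⨾ code (φ /ᶠ (σ T.↑⋆ k))
form-sound dV σ h (axiom (inj₁ (k , _ , _ , _ , _ , p , q , r)))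
  with term-sound (liftImage dV) T.termLift (σ T.↑⋆ k) (liftImage-represents dV σ h k) p
     | term-sound (liftImage dV) T.termLift (σ T.↑⋆ k) (liftImage-represents dV σ h k) q
... | t , eq | u , eq′ with ⨾-injective eq | ⨾-injective eq′ | r
... | refl , refl | refl , refl | inj₁ refl = k , t ≐ u , refl
... | refl , refl | refl , refl | inj₂ refl = k , t ≤ᶠ u , refl
form-sound dV σ h (axiom (inj₂ (k , refl))) = k , ⊥ᶠ , refl
form-sound dV σ h (rule p q (inj₁ (_ , _ , _ , _ , _ , refl , refl , refl)))
  with form-sound dV σ h p | form-sound dV σ h q
... | k , φ , eq | _ , ψ , eq′ with ⨾-injective eq | ⨾-injective eq′
... | refl , e | refl , e′ with ⨾-injective e | ⨾-injective e′
... | refl , refl | refl , refl = k , φ ⇒ ψ , refl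
form-sound dV σ h (rule p _ (inj₂ (k , _ , _ , refl , refl))) with form-sound dV σ h p
... | _ , φ , eq with ⨾-injective eq
... | refl , e with ⨾-injective e
... | refl , refl = k , ∀ᶠ φ , refl

form-complete : ∀ {p m n} {V : Vec ℕ (3 + p) → Set} (dV : Def V) {ρ} (σ : Sub Term m n) →
  Represents V (n ∷ ρ) T.termLift σ → ∀ k (φ : Formula (k + m)) →
  Cl (formᴬ dV) formᴰ (n ∷ ρ) (k ⨾ code φ ⨾ code (φ /ᶠ (σ T.↑⋆ k)))
form-complete {m = m} {n = n} dV {ρ} σ h = complete
  where
  termC : ∀ k (t : Term (k + m)) →
    TermImage dV (codeᵗ t ∷ codeᵗ (t / (σ T.↑⋆ k)) ∷ k ∷ n ∷ ρ)
  termC k = term-complete (liftImage dV) T.termLift (σ T.↑⋆ k) (liftImage-represents dV σ h k)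
  complete : ∀ k (φ : Formula (k + m)) →
    Cl (formᴬ dV) formᴰ (n ∷ ρ) (k ⨾ code φ ⨾ code (φ /ᶠ (σ T.↑⋆ k)))
  complete k (t ≐ u) = axiom (inj₁ (k , _ , _ , _ , _ , termC k t , termC k u , inj₁ refl))
  complete k (t ≤ᶠ u) = axiom (inj₁ (k , _ , _ , _ , _ , termC k t , termC k u , inj₂ refl))
  complete k ⊥ᶠ = axiom (inj₂ (k , refl))
  complete k (φ ⇒ ψ) =
    rule (complete k φ) (complete k ψ) (inj₁ (k , _ , _ , _ , _ , refl , refl , refl))
  complete k (∀ᶠ φ) = rule p p (inj₂ (k , _ , _ , refl , refl))
    where p = complete (suc k) φ

FormImage : ∀ {p} {V : Vec ℕ (3 + p) → Set} → Def V → Vec ℕ (3 + p) → Set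
FormImage dV (c ∷ c′ ∷ ρ) = Cl (formᴬ dV) formᴰ ρ (0 ⨾ c ⨾ c′)

opaque
  formImage : ∀ {p} {V : Vec ℕ (3 + p) → Set} (dV : Def V) → Def (FormImage dV)
  formImage dV = def-⇔ (λ { {_ ∷ _ ∷ _} p → p }) (λ { {_ ∷ _ ∷ _} p → p })
    (pos (rel 2 (closure (formᴬ dV) formᴰ) (lit 0 ⨾ᵉ # 0F ⨾ᵉ # 1F ∷ [])))

formImage-correct : ∀ {p m n} {V : Vec ℕ (3 + p) → Set} (dV : Def V) {ρ} (σ : Sub Term m n) →
  Represents V (n ∷ ρ) T.termLift σ → ∀ {c c′} → FormImage dV (c ∷ c′ ∷ n ∷ ρ) ⇔
  (Σ (Formula m) λ φ → c ≡ code φ × c′ ≡ code (φ /ᶠ σ))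
formImage-correct {m = m} {n} dV {ρ} σ h =
  mk⇔ sound (λ { (φ , refl , refl) → form-complete dV σ h 0 φ })
  where
  sound : ∀ {c c′} → FormImage dV (c ∷ c′ ∷ n ∷ ρ) →
    Σ (Formula m) λ φ → c ≡ code φ × c′ ≡ code (φ /ᶠ σ)
  sound p with form-sound dV σ h p
  ... | _ , φ , eq with ⨾-injective eq
  ... | refl , e = φ , ⨾-injective e

subVarᵖ : Pos 4
subVarᵖ = # 0F ≐ᵖ lit 0 ∧ᵖ # 1F ≐ᵖ # 3F
  ∨ᵖ ∃ᵖ (# 1F ≐ᵖ sucᵉ (# 0F) ∧ᵖ sucᵉ (# 0F) ≤ᵖ # 3F ∧ᵖ # 2F ≐ᵖ lit 0 ⨾ᵉ # 0F)

subVar-represents : ∀ {n} (t : Term n) →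
  Represents ⟦ subVarᵖ ⟧ᵖ (n ∷ codeᵗ t ∷ []) T.termLift (sub t)
subVar-represents t = mk⇔
  (λ { (inj₁ (refl , refl)) → zero , refl , refl
     ; (inj₂ (y , refl , y<n , refl)) → suc (fromℕ< y<n) , cong suc (sym (toℕ-fromℕ< y<n)) ,
         sym (trans (cong codeᵗ (lookup-id (fromℕ< y<n))) (cong (0 ⨾_) (toℕ-fromℕ< y<n))) })
  (λ { (zero , refl , refl)  → inj₁ (refl , refl)
     ; (suc i , refl , refl) → inj₂ (toℕ i , refl , toℕ<n i , cong codeᵗ (lookup-id i)) })

-- The parameter is the target size n + 1, so x < n takes the form x + 2 ≤ n + 1.
wkVarᵖ : Pos 3
wkVarᵖ = sucᵉ (sucᵉ (# 0F)) ≤ᵖ # 2F ∧ᵖ # 1F ≐ᵖ lit 0 ⨾ᵉ sucᵉ (# 0F)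

wkVar-represents : ∀ n → Represents ⟦ wkVarᵖ ⟧ᵖ (suc n ∷ []) T.termLift (wk {n})
wkVar-represents n = mk⇔
  (λ { (s≤s x<n , refl) → fromℕ< x<n , sym (toℕ-fromℕ< x<n) ,
    sym (trans (cong codeᵗ (lookup-wk (fromℕ< x<n)))
               (cong (λ x → 0 ⨾ suc x) (toℕ-fromℕ< x<n))) })
  (λ { (i , refl , refl) → s≤s (toℕ<n i) , cong codeᵗ (lookup-wk i) })

IsTerm : Vec ℕ 2 → Set
IsTerm (n ∷ c ∷ []) = Σ (Term n) λ t → c ≡ codeᵗ t

IsFormula : Vec ℕ 2 → Set
IsFormula (n ∷ c ∷ []) = Σ (Formula n) λ φ → c ≡ code φ

WkImage : Vec ℕ 3 → Set
WkImage (n ∷ c ∷ c′ ∷ []) = Σ (Formula n) λ φ → c ≡ code φ × c′ ≡ code (φ /ᶠ wk)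

SubImage : Vec ℕ 4 → Set
SubImage (n ∷ d ∷ c ∷ c′ ∷ []) = Σ (Term n) λ t → Σ (Formula (suc n)) λ φ →
  d ≡ codeᵗ t × c ≡ code φ × c′ ≡ code (φ /ᶠ sub t)

opaque
  -- Being a term in n variables is read off as lying in the domain of weakening; `isFormula` uses
  -- `wkImage` in the same way.
  isTerm : Def IsTerm
  isTerm = def-⇔
    (λ { {n ∷ c ∷ []} (_ , t , eq , _) → t , eq })
    (λ { {n ∷ c ∷ []} (t , refl) → _ , t , refl , refl })
    (pos (∃ᵖ (rel 3 weakenImage (# 2F ∷ # 0F ∷ # 1F ∷ []))))

  wkImage : Def WkImage
  wkImage = def-⇔
    (λ { {n ∷ c ∷ c′ ∷ []} → to (formImage-correct (pos wkVarᵖ) wk (wkVar-represents n)) })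
    (λ { {n ∷ c ∷ c′ ∷ []} → from (formImage-correct (pos wkVarᵖ) wk (wkVar-represents n)) })
    (pos (rel 3 (formImage (pos wkVarᵖ)) (# 1F ∷ # 2F ∷ sucᵉ (# 0F) ∷ [])))

  isFormula : Def IsFormula
  isFormula = def-⇔
    (λ { {n ∷ c ∷ []} (_ , φ , eq , _) → φ , eq })
    (λ { {n ∷ c ∷ []} (φ , refl) → _ , φ , refl , refl })
    (pos (∃ᵖ (rel 3 wkImage (# 1F ∷ # 2F ∷ # 0F ∷ []))))

  subImage : Def SubImage
  subImage = def-⇔
    (λ { {n ∷ d ∷ c ∷ c′ ∷ []} ((t , refl) , p) → sound t p })
    (λ { {n ∷ d ∷ c ∷ c′ ∷ []} (t , φ , refl , refl , refl) → (t , refl) ,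
      from (formImage-correct (pos subVarᵖ) (sub t) (subVar-represents t)) (φ , refl , refl) })
    (pos (rel 4 isTerm (# 0F ∷ # 1F ∷ []) ∧ᵖ
          rel 4 (formImage (pos subVarᵖ)) (# 2F ∷ # 3F ∷ # 0F ∷ # 1F ∷ [])))
    where
    sound : ∀ {n} (t : Term n) {c c′} → FormImage (pos subVarᵖ) (c ∷ c′ ∷ n ∷ codeᵗ t ∷ []) →
      SubImage (n ∷ codeᵗ t ∷ c ∷ c′ ∷ [])
    sound t p with to (formImage-correct (pos subVarᵖ) (sub t) (subVar-represents t)) p
    ... | φ , eq , eq′ = t , φ , refl , eq , eq′

-- Provability

-- Holds of `[]` vacuously and survives `_↑`, so `σ /ᶠ []` has the same code as `σ`; this is how
-- `hyp` is handled for every number of variables.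
PreservesIndices : ∀ {m n} → Sub Term m n → Set
PreservesIndices {m} {n} σ = ∀ i → Σ (Fin n) λ j → lookup σ i ≡ var j × toℕ j ≡ toℕ i

↑-preservesIndices : ∀ {m n} (σ : Sub Term m n) → PreservesIndices σ → PreservesIndices (σ ↑)
↑-preservesIndices σ h zero = zero , refl , refl
↑-preservesIndices σ h (suc i) with h i
... | j , eq , eq′ =
  suc j , trans (lookup-↑ σ i) (trans (cong T.weaken eq) weaken-var) , cong suc eq′

codeᵗ-/ : ∀ {m n} (t : Term m) {σ : Sub Term m n} → PreservesIndices σ → codeᵗ (t / σ) ≡ codeᵗ t
codeᵗ-/ (var i) h with h i
... | j , eq , eq′ = trans (cong codeᵗ eq) (cong (0 ⨾_) eq′)
codeᵗ-/ 0ᵗ       h = refl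
codeᵗ-/ (sᵗ t)   h = cong (2 ⨾_) (codeᵗ-/ t h)
codeᵗ-/ (t +ᵗ u) h = cong₂ (λ a b → 3 ⨾ a ⨾ b) (codeᵗ-/ t h) (codeᵗ-/ u h)
codeᵗ-/ (t *ᵗ u) h = cong₂ (λ a b → 4 ⨾ a ⨾ b) (codeᵗ-/ t h) (codeᵗ-/ u h)

code-/ : ∀ {m n} (φ : Formula m) {σ : Sub Term m n} → PreservesIndices σ → code (φ /ᶠ σ) ≡ code φ
code-/ (t ≐ u)  h = cong₂ (λ a b → 5 ⨾ a ⨾ b) (codeᵗ-/ t h) (codeᵗ-/ u h)
code-/ (t ≤ᶠ u) h = cong₂ (λ a b → 6 ⨾ a ⨾ b) (codeᵗ-/ t h) (codeᵗ-/ u h)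
code-/ ⊥ᶠ       h = refl
code-/ (φ ⇒ ψ)  h = cong₂ (λ a b → 8 ⨾ a ⨾ b) (code-/ φ h) (code-/ ψ h)
code-/ (∀ᶠ φ) {σ} h = cong (9 ⨾_) (code-/ φ (↑-preservesIndices σ h))

-- For modus ponens, where the major premise is known to be an implication only through its code.
code-⇒⁻¹ : ∀ {n} (φ : Formula n) {a b} → 8 ⨾ a ⨾ b ≡ code φ →
  Σ (Formula n) λ φ₁ → Σ (Formula n) λ φ₂ → φ ≡ φ₁ ⇒ φ₂ × a ≡ code φ₁ × b ≡ code φ₂
code-⇒⁻¹ (φ ⇒ ψ) eq = φ , ψ , refl , binary-injective eq
code-⇒⁻¹ (_ ≐ _)  eq = tag-clash (λ ()) eq
code-⇒⁻¹ (_ ≤ᶠ _) eq = tag-clash (λ ()) eq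
code-⇒⁻¹ ⊥ᶠ       eq = tag-clash (λ ()) eq
code-⇒⁻¹ (∀ᶠ _)   eq = tag-clash (λ ()) eq

infixr 8 _⇒ᵉ_

_⇒ᵉ_ : ∀ {n} → Exp n → Exp n → Exp n
e ⇒ᵉ f = lit 8 ⨾ᵉ e ⨾ᵉ f

⊥ᵉ : ∀ {n} → Exp n
⊥ᵉ = lit 7 ⨾ᵉ lit 0

∀ᵉ : ∀ {n} → Exp n → Exp n
∀ᵉ e = lit 9 ⨾ᵉ e

hypᵖ : {H : Vec ℕ 1 → Set} → Def H → Pos 1
hypᵖ H = ∃ᵖ (∃ᵖ (# 2F ≐ᵖ # 1F ⨾ᵉ # 0F ∧ᵖ rel 3 H (# 0F ∷ [])))

Kᵖ Sᵖ DNᵖ ∀Eᵖ ∀Iᵖ reflᵖ leibnizᵖ : Pos 1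
Kᵖ = ∃ᵖ (∃ᵖ (∃ᵖ (
  rel 4 isFormula (# 2F ∷ # 1F ∷ []) ∧ᵖ rel 4 isFormula (# 2F ∷ # 0F ∷ []) ∧ᵖ
  # 3F ≐ᵖ # 2F ⨾ᵉ # 1F ⇒ᵉ # 0F ⇒ᵉ # 1F)))
Sᵖ = ∃ᵖ (∃ᵖ (∃ᵖ (∃ᵖ (
  rel 5 isFormula (# 3F ∷ # 2F ∷ []) ∧ᵖ rel 5 isFormula (# 3F ∷ # 1F ∷ []) ∧ᵖ
  rel 5 isFormula (# 3F ∷ # 0F ∷ []) ∧ᵖ
  # 4F ≐ᵖ # 3F ⨾ᵉ (# 2F ⇒ᵉ # 1F ⇒ᵉ # 0F) ⇒ᵉ (# 2F ⇒ᵉ # 1F) ⇒ᵉ # 2F ⇒ᵉ # 0F))))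
DNᵖ = ∃ᵖ (∃ᵖ (
  rel 3 isFormula (# 1F ∷ # 0F ∷ []) ∧ᵖ # 2F ≐ᵖ # 1F ⨾ᵉ ((# 0F ⇒ᵉ ⊥ᵉ) ⇒ᵉ ⊥ᵉ) ⇒ᵉ # 0F))
∀Eᵖ = ∃ᵖ (∃ᵖ (∃ᵖ (∃ᵖ (
  rel 5 subImage (# 3F ∷ # 2F ∷ # 1F ∷ # 0F ∷ []) ∧ᵖ # 4F ≐ᵖ # 3F ⨾ᵉ ∀ᵉ (# 1F) ⇒ᵉ # 0F))))
∀Iᵖ = ∃ᵖ (∃ᵖ (∃ᵖ (∃ᵖ (
  rel 5 wkImage (# 3F ∷ # 2F ∷ # 1F ∷ []) ∧ᵖ rel 5 isFormula (sucᵉ (# 3F) ∷ # 0F ∷ []) ∧ᵖ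
  # 4F ≐ᵖ # 3F ⨾ᵉ ∀ᵉ (# 1F ⇒ᵉ # 0F) ⇒ᵉ # 2F ⇒ᵉ ∀ᵉ (# 0F)))))
reflᵖ = ∃ᵖ (∃ᵖ (
  rel 3 isTerm (# 1F ∷ # 0F ∷ []) ∧ᵖ # 2F ≐ᵖ # 1F ⨾ᵉ lit 5 ⨾ᵉ # 0F ⨾ᵉ # 0F))
leibnizᵖ = ∃ᵖ (∃ᵖ (∃ᵖ (∃ᵖ (∃ᵖ (∃ᵖ (
  rel 7 subImage (# 5F ∷ # 4F ∷ # 2F ∷ # 1F ∷ []) ∧ᵖ
  rel 7 subImage (# 5F ∷ # 3F ∷ # 2F ∷ # 0F ∷ []) ∧ᵖ
  # 6F ≐ᵖ # 5F ⨾ᵉ (lit 5 ⨾ᵉ # 4F ⨾ᵉ # 3F) ⇒ᵉ # 1F ⇒ᵉ # 0F))))))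

provᴬ : {H : Vec ℕ 1 → Set} → Def H → Pos 1
provᴬ H = hypᵖ H ∨ᵖ Kᵖ ∨ᵖ Sᵖ ∨ᵖ DNᵖ ∨ᵖ ∀Eᵖ ∨ᵖ ∀Iᵖ ∨ᵖ reflᵖ ∨ᵖ leibnizᵖ

provᴰ : Pos 3
provᴰ = ∃ᵖ (∃ᵖ (∃ᵖ (
    # 3F ≐ᵖ # 2F ⨾ᵉ # 1F ⇒ᵉ # 0F ∧ᵖ # 4F ≐ᵖ # 2F ⨾ᵉ # 1F ∧ᵖ # 5F ≐ᵖ # 2F ⨾ᵉ # 0F)))
  ∨ᵖ ∃ᵖ (∃ᵖ (# 2F ≐ᵖ sucᵉ (# 1F) ⨾ᵉ # 0F ∧ᵖ # 4F ≐ᵖ # 1F ⨾ᵉ ∀ᵉ (# 0F)))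

module _ {ℓ} (T : Theory ℓ) {H : Vec ℕ 1 → Set} (dH : Def H)
  (H⇔ : ∀ {c} → H (c ∷ []) ⇔ Σ Sentence λ σ → c ≡ code σ × σ ∈ T) where

  Provable : ℕ → Set ℓ
  Provable w = ∃ λ n → Σ (Formula n) λ φ → w ≡ n ⨾ code φ × T ⊢ φ

  axiom-sound : ∀ {w} → ⟦ provᴬ dH ⟧ᵖ (w ∷ []) → Provable w
  axiom-sound (inj₁ (n , _ , refl , p)) with to H⇔ p
  ... | σ , refl , σ∈T = n , σ /ᶠ [] , cong (n ⨾_) (sym (code-/ σ λ ())) , hyp σ∈T
  axiom-sound (inj₂ (inj₁ (n , _ , _ , (φ , refl) , (ψ , refl) , refl))) =
    n , _ , refl , ax-K φ ψ
  axiom-sound (inj₂ (inj₂ (inj₁ (n , _ , _ , _ , (φ , refl) , (ψ , refl) , (χ , refl) , refl)))) =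
    n , _ , refl , ax-S φ ψ χ
  axiom-sound (inj₂ (inj₂ (inj₂ (inj₁ (n , _ , (φ , refl) , refl))))) =
    n , _ , refl , ax-DN φ
  axiom-sound (inj₂ (inj₂ (inj₂ (inj₂ (inj₁
    (n , _ , _ , _ , (t , φ , refl , refl , refl) , refl)))))) =
    n , _ , refl , ax-∀E φ t
  axiom-sound (inj₂ (inj₂ (inj₂ (inj₂ (inj₂ (inj₁
    (n , _ , _ , _ , (φ , refl , refl) , (ψ , refl) , refl))))))) =
    n , _ , refl , ax-∀I φ ψ
  axiom-sound (inj₂ (inj₂ (inj₂ (inj₂ (inj₂ (inj₂ (inj₁
    (n , _ , (t , refl) , refl)))))))) =
    n , _ , refl , ax-≐ t
  axiom-sound (inj₂ (inj₂ (inj₂ (inj₂ (inj₂ (inj₂ (inj₂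
    (n , _ , _ , _ , _ , _ , (t , φ , refl , refl , refl) , (u , ψ , refl , eq , refl) , refl))))))))
    -- The two instances were described by a common code; in n + 1 variables it belongs to a single
    -- formula.
    with code-injective φ ψ eq
  ... | refl = n , _ , refl , ax-sub φ t u

  prov-sound : ∀ {w} → Cl (provᴬ dH) provᴰ [] w → Provable w
  prov-sound (axiom a) = axiom-sound a
  prov-sound (rule p q (inj₁ (_ , _ , _ , refl , refl , refl))) with prov-sound p | prov-sound q
  ... | n , χ , eq , d | _ , φ , eq′ , e with ⨾-injective eq | ⨾-injective eq′
  ... | refl , eq″ | refl , refl with code-⇒⁻¹ χ eq″
  ... | φ′ , ψ , refl , eq‴ , refl with code-injective φ φ′ eq‴
  ... | refl = n , ψ , refl , mp d e
  prov-sound (rule p _ (inj₂ (n , _ , refl , refl))) with prov-sound p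
  ... | _ , φ , eq , d with ⨾-injective eq
  ... | refl , refl = n , ∀ᶠ φ , refl , gen d

  prov-complete : ∀ {n} {φ : Formula n} → T ⊢ φ → Cl (provᴬ dH) provᴰ [] (n ⨾ code φ)
  prov-complete (hyp {n} {σ} σ∈T) =
    axiom (inj₁ (n , _ , cong (n ⨾_) (code-/ σ λ ()) , from H⇔ (σ , refl , σ∈T)))
  prov-complete (mp d e) =
    rule (prov-complete d) (prov-complete e) (inj₁ (_ , _ , _ , refl , refl , refl))
  prov-complete (gen d) =
    rule (prov-complete d) (prov-complete d) (inj₂ (_ , _ , refl , refl))
  prov-complete (ax-K φ ψ) =
    axiom (inj₂ (inj₁ (_ , _ , _ , (φ , refl) , (ψ , refl) , refl)))
  prov-complete (ax-S φ ψ χ) =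
    axiom (inj₂ (inj₂ (inj₁ (_ , _ , _ , _ , (φ , refl) , (ψ , refl) , (χ , refl) , refl))))
  prov-complete (ax-DN φ) =
    axiom (inj₂ (inj₂ (inj₂ (inj₁ (_ , _ , (φ , refl) , refl)))))
  prov-complete (ax-∀E φ t) =
    axiom (inj₂ (inj₂ (inj₂ (inj₂ (inj₁
      (_ , _ , _ , _ , (t , φ , refl , refl , refl) , refl))))))
  prov-complete (ax-∀I φ ψ) =
    axiom (inj₂ (inj₂ (inj₂ (inj₂ (inj₂ (inj₁
      (_ , _ , _ , _ , (φ , refl , refl) , (ψ , refl) , refl)))))))
  prov-complete (ax-≐ t) =
    axiom (inj₂ (inj₂ (inj₂ (inj₂ (inj₂ (inj₂ (inj₁ (_ , _ , (t , refl) , refl))))))))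
  prov-complete (ax-sub φ t u) =
    axiom (inj₂ (inj₂ (inj₂ (inj₂ (inj₂ (inj₂ (inj₂ (_ , _ , _ , _ , _ , _ ,
      (t , φ , refl , refl , refl) , (u , φ , refl , refl , refl) , refl))))))))

  prov-⇔ : ∀ {c} → Cl (provᴬ dH) provᴰ [] (0 ⨾ c) ⇔ c ∈ Pr T
  prov-⇔ = mk⇔ sound (λ { (σ , eq , d) →
    subst (λ c → Cl (provᴬ dH) provᴰ [] (0 ⨾ c)) (trans (code-⌜⌝ σ) eq) (prov-complete d) })
    where
    sound : ∀ {c} → Cl (provᴬ dH) provᴰ [] (0 ⨾ c) → c ∈ Pr T
    sound p with prov-sound p
    ... | _ , σ , eq , d with ⨾-injective eq
    ... | refl , eq′ = σ , trans (sym (code-⌜⌝ σ)) (sym eq′) , d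

  Pr-definable : Definable (Pr T)
  Pr-definable = formula dP , λ c → mk⇔
    (λ h ¬p → to (correct dP (c ∷ [])) h λ q → ¬p (to prov-⇔ q))
    (λ h → from (correct dP (c ∷ [])) λ ¬q → h λ p → ¬q (from prov-⇔ p))
    where
    dP = pos (rel 1 (closure (provᴬ dH) provᴰ) (lit 0 ⨾ᵉ # 0F ∷ []))

Recursive⇒Pr-definable : ∀ {ℓ} (T : Theory ℓ) → Recursive (GödelNumbers T) → Definable (Pr T)
Recursive⇒Pr-definable T rec with Recursive⇒Def (GödelNumbers T) rec
... | f , dH , H⇔ = Pr-definable T dH λ {c} → mk⇔ (sound c) (complete c)
  where
  sound : ∀ c → f ∙ c ∷ [] ⇓ 1 → Σ Sentence λ σ → c ≡ code σ × σ ∈ T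
  sound c p with to (H⇔ c) p
  ... | σ , eq , σ∈T = σ , sym (trans (code-⌜⌝ σ) eq) , σ∈T
  complete : ∀ c → (Σ Sentence λ σ → c ≡ code σ × σ ∈ T) → f ∙ c ∷ [] ⇓ 1
  complete c (σ , eq , σ∈T) = from (H⇔ c) (σ , sym (trans eq (code-⌜⌝ σ)) , σ∈T)

-- Carries definability from `Pr T′` over to `Pr T`, since both theories have the same theorems.
Definable-⇔ : ∀ {ℓ} {P Q : ℕ → Set ℓ} → (∀ n → P n ⇔ Q n) → Definable P → Definable Q
Definable-⇔ P⇔Q (φ , h) = φ , λ n → mk⇔
  (λ a ¬q → to (h n) a (¬q ∘ to (P⇔Q n)))
  (λ ¬¬q → from (h n) λ ¬p → ¬¬q (¬p ∘ from (P⇔Q n)))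

corollary1 : ∀ {ℓ} (T : Theory ℓ) →
    (Definable (Pr T) → Sound T → Incomplete T) ×
    (RecursivelyAxiomatizable T → Definable (Pr T))
corollary1 T = incomplete T , λ { (T′ , rec , T⇔T′) → Definable-⇔
  (λ n → mk⇔ (λ { (σ , eq , d) → σ , eq , from (T⇔T′ σ) d }) (λ { (σ , eq , d) → σ , eq , to (T⇔T′ σ) d }))
  (Recursive⇒Pr-definable T′ rec) }
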